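{- For every positive integer $N$, the linear system $$\gamma_N^{a,a}-\lambda_N^{a,a}=\tilde g^{a}_2(q)\quad\forall a\in\mathbb{Z}/N\mathbb{Z},\qquad \gamma_N^{a,b}+\gamma_N^{b,a}-2\lambda_N^{a,b}=0\quad\forall a\ne b\in\mathbb{Z}/N\mathbb{Z},$$ $$\gamma_N^{a+b,a}+\gamma_N^{a+b,b}-2\lambda_N^{a,b}=f^{a}_{2}(q)+f^{b}_{2}(q)\quad\forall a,b\in\mathbb{Z}/N\mathbb{Z}$$ in the unknowns $\gamma_N^{a,b}$ and $\lambda_N^{a,b}=\lambda_N^{b,a}$ ($0\le a,b<N$) has infinitely many sets of solutions in terms of (i.e. given by linear combinations of) the series $f_2^a(q)$ and $\tilde g_2^a(q)$ ($0\le a<N$). Moreover, one can always choose $$\{\gamma_N^{a,b}:0\le b<a<N\}\cup\{\gamma_N^{N-a,N-a}:1\le a\le N,\ a\mid N\}$$ as the $N(N-1)/2+\nu(N)$ free variables.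
   Context: Let $\eta=e^{2\pi i/N}$. Superscripts are residue classes modulo $N$, represented by integers in $\{0,\dots,N-1\}$. $\nu(N)$ is the number of positive divisors of $N$ (including $1$ and $N$). For $a\in\mathbb{Z}/N\mathbb{Z}$, $$\tilde g_2^a(q)=\frac1{N^2}\sum_{n,u\ge1}\eta^{au}u\,q^{nu},\qquad f_2^a(q)=\frac1{N^2}\sum_{n,u\ge1}\eta^{au}n\,q^{nu},$$ as power series in $q$. The unknowns are power series in $q$. "Free variables" has its usual linear-algebra meaning: these unknowns can be assigned arbitrary values, and then the remaining unknowns are uniquely determined by the system. -}

module Defs where

open import Algebra.Apartness.Bundles using (HeytingField; HeytingCommutativeRing)
open import Algebra.Bundles using (CommutativeRing)
import Algebra.Properties.CommutativeMonoid.Sum as Sum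
import Algebra.Properties.Semiring.Exp as Exp
import Algebra.Properties.Semiring.Mult as Mult
open import Data.Bool.Base using (if_then_else_)
open import Data.Fin.Base using (Fin; toℕ)
import Data.Fin.Properties as Fin
open import Data.List.Base using (List; length; filter; map; upTo; allFin; cartesianProduct)
open import Data.Nat.Base as ℕ using (ℕ; suc; NonZero; _∸_)
open import Data.Nat.Divisibility using (_∣_; _∣?_)
open import Data.Nat.DivMod using (_mod_)
import Data.Nat.Properties as ℕ
open import Data.Product.Base using (Σ-syntax; _×_; _,_; proj₁)
open import Level using (Level; _⊔_)
open import Relation.Binary.Core using (Rel)
open import Relation.Binary.PropositionalEquality using (_≡_; _≢_; refl; sym; trans; cong; subst)
open import Relation.Nullary using (¬_; Dec; yes; no; does)
open import Relation.Unary using (Pred; Decidable)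

private variable
  N : ℕ

-- Residue classes modulo N are represented by Fin N; this is addition of classes.
_⊕_ : .{{_ : NonZero N}} → Fin N → Fin N → Fin N
_⊕_ {N} a b = (toℕ a ℕ.+ toℕ b) mod N

ν : ℕ → ℕ
ν N = length (filter (_∣? N) (map suc (upTo N)))

-- The positions (a , b) of the unknowns γ^{a,b} that are claimed to be free.
data IsFree {N : ℕ} : Pred (Fin N × Fin N) Level.zero where
  below    : ∀ {a b} → toℕ b ℕ.< toℕ a → IsFree (a , b)
  diagonal : ∀ {a b} d → 1 ℕ.≤ d → d ℕ.≤ N → d ∣ N →
             toℕ a ≡ N ∸ d → toℕ b ≡ N ∸ d → IsFree (a , b)

isFree? : Decidable (IsFree {N})
isFree? {N} (a , b) with toℕ b ℕ.<? toℕ a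
... | yes b<a = yes (below b<a)
... | no b≮a with a Fin.≟ b | (N ∸ toℕ a) ∣? N
...   | no a≢b   | _ = no λ
        { (below b<a)                → b≮a b<a
        ; (diagonal _ _ _ _ a≡ b≡) → a≢b (Fin.toℕ-injective (trans a≡ (sym b≡))) }
...   | yes _    | no N-a∤N = no λ
        { (below b<a)                    → b≮a b<a
        ; (diagonal d _ d≤N d∣N a≡ _) →
            N-a∤N (subst (_∣ N) (sym (trans (cong (N ∸_) a≡) (ℕ.m∸[m∸n]≡n d≤N))) d∣N) }
...   | yes refl | yes N-a∣N = yes
        (diagonal (N ∸ toℕ a) (ℕ.m<n⇒0<n∸m (Fin.toℕ<n a)) (ℕ.m∸n≤m N (toℕ a)) N-a∣N a≡ a≡)
        where
        a≡ : toℕ a ≡ N ∸ (N ∸ toℕ a)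
        a≡ = sym (ℕ.m∸[m∸n]≡n (ℕ.<⇒≤ (Fin.toℕ<n a)))

freePositions : ∀ N → List (Fin N × Fin N)
freePositions N = filter isFree? (cartesianProduct (allFin N) (allFin N))

-- The intended coefficient field is ℂ with η = e^{2πi/N}; only the following is
-- used of it: a field of characteristic 0 with a primitive N-th root of unity η.
module OverField {c ℓ₁ ℓ₂ : Level} (K : HeytingField c ℓ₁ ℓ₂) where

  open HeytingField K
    using (Carrier; _≈_; _#_; _+_; _*_; _-_; 0#; 1#; #⇒invertible; heytingCommutativeRing)
  open CommutativeRing (HeytingCommutativeRing.commutativeRing heytingCommutativeRing)
    using (semiring; +-commutativeMonoid)
  open Sum +-commutativeMonoid using (sum-syntax)
  open Exp semiring using (_^_)
  open Mult semiring using () renaming (_×_ to _×ᴷ_)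

  CharacteristicZero : Set ℓ₂
  CharacteristicZero = ∀ n → .{{NonZero n}} → (n ×ᴷ 1#) # 0#

  record IsPrimitiveRoot (N : ℕ) (η : Carrier) : Set ℓ₁ where
    field
      η^N≈1 : η ^ N ≈ 1#
      η^k≉1 : ∀ k → 0 ℕ.< k → k ℕ.< N → ¬ (η ^ k ≈ 1#)

  -- A formal power series in q, given by its coefficients.
  PowerSeries : Set c
  PowerSeries = ℕ → Carrier

  infix  4 _≈ₛ_
  infixl 6 _+ₛ_ _-ₛ_
  infixl 7 _·ₛ_

  _≈ₛ_ : Rel PowerSeries ℓ₁
  f ≈ₛ g = ∀ m → f m ≈ g m

  0ₛ : PowerSeries
  0ₛ _ = 0#

  _+ₛ_ _-ₛ_ : PowerSeries → PowerSeries → PowerSeries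
  (f +ₛ g) m = f m + g m
  (f -ₛ g) m = f m - g m

  _·ₛ_ : Carrier → PowerSeries → PowerSeries
  (x ·ₛ f) m = x * f m

  2# : Carrier
  2# = 1# + 1#

  -- The series ∑_{n,u≥1} c(n,u) q^{nu}.  The pairs n , u ≥ 1 with n u = m
  -- satisfy n , u ≤ m, so the coefficient of q^m is a sum over 1 ≤ n , u ≤ m
  -- (and the constant term is 0).
  doubleSeries : (ℕ → ℕ → Carrier) → PowerSeries
  doubleSeries c m = ∑[ i < m ] ∑[ j < m ]
    (let n = suc (toℕ i) ; u = suc (toℕ j) in
     if does (n ℕ.* u ℕ.≟ m) then c n u else 0#)

  module LinearSystem (char0 : CharacteristicZero)
                      (N : ℕ) .{{N≢0 : NonZero N}} (η : Carrier) where

    -- #⇒invertible inverts the difference N - 0.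
    1/N : Carrier
    1/N = proj₁ (#⇒invertible (char0 N))

    g̃₂ f₂ : Fin N → PowerSeries
    g̃₂ a = (1/N * 1/N) ·ₛ doubleSeries (λ n u → η ^ (toℕ a ℕ.* u) * (u ×ᴷ 1#))
    f₂ a = (1/N * 1/N) ·ₛ doubleSeries (λ n u → η ^ (toℕ a ℕ.* u) * (n ×ᴷ 1#))

    record Unknowns : Set c where
      field
        γ   : Fin N → Fin N → PowerSeries
        lam : Fin N → Fin N → PowerSeries

    open Unknowns

    infix 4 _≈ᵤ_

    _≈ᵤ_ : Rel Unknowns ℓ₁
    x ≈ᵤ y = (∀ a b → γ x a b ≈ₛ γ y a b) × (∀ a b → lam x a b ≈ₛ lam y a b)

    record IsSolution (x : Unknowns) : Set ℓ₁ where
      field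
        lam-sym : ∀ a b → lam x a b ≈ₛ lam x b a
        eq-diag : ∀ a → γ x a a -ₛ lam x a a ≈ₛ g̃₂ a
        eq-off  : ∀ a b → a ≢ b → γ x a b +ₛ γ x b a -ₛ 2# ·ₛ lam x a b ≈ₛ 0ₛ
        eq-sum  : ∀ a b →
          γ x (a ⊕ b) a +ₛ γ x (a ⊕ b) b -ₛ 2# ·ₛ lam x a b ≈ₛ f₂ a +ₛ f₂ b

    InSpan : PowerSeries → Set (c ⊔ ℓ₁)
    InSpan h = Σ[ μ ∈ (Fin N → Carrier) ] Σ[ κ ∈ (Fin N → Carrier) ]
      (h ≈ₛ λ m → ∑[ a < N ] (μ a * f₂ a m + κ a * g̃₂ a m))

    IsExpressible : Unknowns → Set (c ⊔ ℓ₁)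
    IsExpressible x = (∀ a b → InSpan (γ x a b)) × (∀ a b → InSpan (lam x a b))

    -- φ is total, but only its values at positions satisfying P matter.
    AgreesOn : Pred (Fin N × Fin N) Level.zero → (Fin N → Fin N → PowerSeries) →
               Unknowns → Set ℓ₁
    AgreesOn P φ x = ∀ a b → P (a , b) → γ x a b ≈ₛ φ a b

    AreFreeVariables : Pred (Fin N × Fin N) Level.zero → Set (c ⊔ ℓ₁)
    AreFreeVariables P = ∀ (φ : Fin N → Fin N → PowerSeries) →
      Σ[ x ∈ Unknowns ] (IsSolution x × AgreesOn P φ x
              × (∀ y → IsSolution y → AgreesOn P φ y → y ≈ᵤ x))

-- Eliminating λ leaves, with δ the Kronecker symbol, the equations
--   E(a,b) :  γ(a+b,a) + γ(a+b,b) + 2 δ(a,b) g̃(a) = γ(a,b) + γ(b,a) + f(a) + f(b).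
-- For a < b, E(a,b) computes γ(a,b) from the values γ(c,d) with c > d and the
-- diagonal.  Negation turns this recursion into a Euclidean tree
-- (x,y) ↦ (x+y,x) , (x+y,y) bounded by N, which meets the diagonal only if
-- gcd(x,y) divides N.  Hence E(a,a) computes γ(a,a) unless N - a divides N, and
-- uniqueness follows.  For existence there remain the equations E(-d,-d) with
-- d ∣ N.  Summed over H × H, H = dℤ/N, all γ-terms of E cancel, and what is left
-- is the distribution relation |H| ∑_H f = ∑_H g̃, which holds because η is a
-- primitive root of unity.  So E(-d,-d) follows from the other equations on
-- H × H, by induction over the divisors.

module Submission where

open import Defs
open import Algebra.Apartness.Bundles using (HeytingField; HeytingCommutativeRing)
open import Algebra.Bundles using (AbelianGroup; CommutativeMonoid; CommutativeRing)
import Algebra.Construct.Pointwise as Pointwise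
import Algebra.Properties.AbelianGroup as AbelianGroupProperties
import Algebra.Properties.CommutativeMonoid.Sum as Sum
import Algebra.Properties.CommutativeSemigroup as CommutativeSemigroupProperties
import Algebra.Properties.Ring as RingProperties
import Algebra.Properties.Semiring.Exp as Exp
import Algebra.Properties.Semiring.Mult as Mult
import Algebra.Properties.Semiring.Sum as SemiringSum
import Algebra.Solver.CommutativeMonoid as CommutativeMonoidSolver
open import Data.Bool.Base using (Bool; true; false; if_then_else_)
open import Data.Fin.Base using (Fin; zero; suc; toℕ; punchIn; opposite)
import Data.Fin.Permutation as Permutation
import Data.Fin.Properties as Fin
open import Data.List.Base using (length; filter; map; tabulate; applyUpTo; cartesianProduct; _++_)
open import Data.List.Properties using (filter-++; length-++; map-upTo; map-tabulate)
open import Data.Nat.Base as ℕ using (ℕ; NonZero; zero; suc; _∸_; z≤n; s≤s)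
open import Data.Nat.Divisibility
  using (_∣_; _∣?_; divides; _∣0; 1∣_; ∣-refl; ∣m∣n⇒∣m+n; ∣m+n∣m⇒∣n; ∣⇒≤; m%n≡0⇒n∣m; *-cancelˡ-∣)
open import Data.Nat.DivMod
  using (_%_; _mod_; m<n⇒m%n≡m; m≤n⇒[n∸m]%m≡n%m; %-distribˡ-+; m%n%n≡m%n;
         [m+n]%n≡m%n; m%n<n; m≡m%n+[m/n]*n; m*n/n≡m)
open import Data.Nat.Induction using (<-rec)
import Data.Nat.Properties as ℕ
open import Data.Product.Base using (Σ-syntax; _×_; _,_; proj₁; proj₂)
open import Data.Sum.Base using (_⊎_; inj₁; inj₂)
open import Data.Vec.Functional using (removeAt)
open import Function.Base using (_∘_; id)
open import Function.Bundles using (mk⇔)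
open import Function.Definitions using (Injective)
open import Level using (Level)
open import Relation.Binary.Definitions using (tri<; tri≈; tri>)
open import Relation.Binary.PropositionalEquality as ≡ using (_≡_; _≢_)
import Relation.Binary.Reasoning.Setoid as SetoidReasoning
open import Relation.Nullary using (¬_; Dec; yes; no; does; contradiction)
open import Relation.Nullary.Decidable using (does-⇔; dec-true; dec-false)
open import Relation.Unary using (Decidable; Pred)

-- As E(a , b) and E(b , a) coincide, there are N(N+1)/2 equations in the N² unknowns γ, while the
-- claimed free variables leave room for only N(N+1)/2 - ν(N) independent ones. The surplus is
-- accounted for by the ν(N) subgroups of ℤ/N: each yields one linear dependency. The dependency of
-- H = dℤ/N can be spent on E(-d,-d) because N - d is the largest representative in H, so every
-- other diagonal equation on H × H sits at a smaller index. The delicate point of existence is an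
-- apparent circle: the recursion starts from a diagonal, and the diagonal entries at non-divisors
-- are in turn read off from values of the recursion. Those particular values never look at the
-- diagonal, so a provisional diagonal already computes them correctly. The distribution relation is
-- a symmetry: for H of order M, summing η^(a u) over a in H keeps the u = v M, and both sides
-- become sums over n v M = m that differ by exchanging n and v.

-- Residue classes through their representatives: carries, translations, subgroups

module _ {N : ℕ} .{{_ : NonZero N}} where

  private variable
    a b : Fin N
    d : ℕ

  toℕ-⊕ : ∀ (a b : Fin N) → toℕ (a ⊕ b) ≡ (toℕ a ℕ.+ toℕ b) % N
  toℕ-⊕ a b = Fin.toℕ-fromℕ< (m%n<n (toℕ a ℕ.+ toℕ b) N)

  ⊕-comm : ∀ (a b : Fin N) → a ⊕ b ≡ b ⊕ a
  ⊕-comm a b = ≡.cong (_mod N) (ℕ.+-comm (toℕ a) (toℕ b))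

  ⊕-cases : ∀ (a b : Fin N) → toℕ (a ⊕ b) ≡ toℕ a ℕ.+ toℕ b
                            ⊎ toℕ (a ⊕ b) ℕ.+ N ≡ toℕ a ℕ.+ toℕ b
  ⊕-cases a b with toℕ a ℕ.+ toℕ b ℕ.<? N
  ... | yes a+b<N = inj₁ (≡.trans (toℕ-⊕ a b) (m<n⇒m%n≡m a+b<N))
  ... | no a+b≮N  = inj₂ (begin
    toℕ (a ⊕ b) ℕ.+ N                ≡⟨ ≡.cong (ℕ._+ N) (toℕ-⊕ a b) ⟩
    (toℕ a ℕ.+ toℕ b) % N ℕ.+ N      ≡⟨ ≡.cong (ℕ._+ N) (m≤n⇒[n∸m]%m≡n%m N≤a+b) ⟨
    (toℕ a ℕ.+ toℕ b ∸ N) % N ℕ.+ N  ≡⟨ ≡.cong (ℕ._+ N) (m<n⇒m%n≡m a+b-N<N) ⟩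
    toℕ a ℕ.+ toℕ b ∸ N ℕ.+ N        ≡⟨ ℕ.m∸n+n≡m N≤a+b ⟩
    toℕ a ℕ.+ toℕ b                  ∎)
    where
    open ≡.≡-Reasoning
    N≤a+b : N ℕ.≤ toℕ a ℕ.+ toℕ b
    N≤a+b = ℕ.≮⇒≥ a+b≮N
    a+b-N<N : toℕ a ℕ.+ toℕ b ∸ N ℕ.< N
    a+b-N<N = ℕ.+-cancelʳ-< N _ N (≡.subst (ℕ._< N ℕ.+ N) (≡.sym (ℕ.m∸n+n≡m N≤a+b))
                (ℕ.+-mono-< (Fin.toℕ<n a) (Fin.toℕ<n b)))

  no-carry⇒≥ʳ : toℕ (a ⊕ b) ≡ toℕ a ℕ.+ toℕ b → toℕ b ℕ.≤ toℕ (a ⊕ b)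
  no-carry⇒≥ʳ {a} {b} eq = ≡.subst (toℕ b ℕ.≤_) (≡.sym eq) (ℕ.m≤n+m (toℕ b) (toℕ a))

  carry⇒<ˡ : toℕ (a ⊕ b) ℕ.+ N ≡ toℕ a ℕ.+ toℕ b → toℕ (a ⊕ b) ℕ.< toℕ a
  carry⇒<ˡ {a} {b} eq = ℕ.+-cancelʳ-< N _ (toℕ a)
    (≡.subst (ℕ._< toℕ a ℕ.+ N) (≡.sym eq) (ℕ.+-monoʳ-< (toℕ a) (Fin.toℕ<n b)))

  -- In the coordinate N - a, addition with a carry becomes plain addition of naturals. Hence a
  -- common divisor of N - a and N - b passes to N - (a ⊕ b).
  carry⇒neg : toℕ (a ⊕ b) ℕ.+ N ≡ toℕ a ℕ.+ toℕ b →
              N ∸ toℕ (a ⊕ b) ≡ (N ∸ toℕ a) ℕ.+ (N ∸ toℕ b)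
  carry⇒neg {a} {b} eq = ℕ.+-cancelʳ-≡ (toℕ (a ⊕ b) ℕ.+ N) _ _ (begin
    (N ∸ toℕ (a ⊕ b)) ℕ.+ (toℕ (a ⊕ b) ℕ.+ N)
      ≡⟨ ℕ.+-assoc (N ∸ toℕ (a ⊕ b)) _ N ⟨
    (N ∸ toℕ (a ⊕ b)) ℕ.+ toℕ (a ⊕ b) ℕ.+ N
      ≡⟨ ≡.cong (ℕ._+ N) (complement (a ⊕ b)) ⟩
    N ℕ.+ N
      ≡⟨ ≡.cong₂ ℕ._+_ (complement a) (complement b) ⟨
    (N ∸ toℕ a) ℕ.+ toℕ a ℕ.+ ((N ∸ toℕ b) ℕ.+ toℕ b)
      ≡⟨ interchange (N ∸ toℕ a) (toℕ a) (N ∸ toℕ b) (toℕ b) ⟩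
    (N ∸ toℕ a) ℕ.+ (N ∸ toℕ b) ℕ.+ (toℕ a ℕ.+ toℕ b)
      ≡⟨ ≡.cong ((N ∸ toℕ a) ℕ.+ (N ∸ toℕ b) ℕ.+_) eq ⟨
    (N ∸ toℕ a) ℕ.+ (N ∸ toℕ b) ℕ.+ (toℕ (a ⊕ b) ℕ.+ N) ∎)
    where
    open ≡.≡-Reasoning
    open CommutativeSemigroupProperties ℕ.+-commutativeSemigroup using (interchange)
    complement : ∀ (a : Fin N) → (N ∸ toℕ a) ℕ.+ toℕ a ≡ N
    complement a = ℕ.m∸n+n≡m (ℕ.<⇒≤ (Fin.toℕ<n a))

  ⊕-permutation : Fin N → Permutation.Permutation′ N
  -- The natural number N ∸ toℕ a stands for -a without being reduced first, so a = 0 is not a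
  -- special case.
  ⊕-permutation a = Permutation.permutation (a ⊕_) (λ c → (toℕ c ℕ.+ (N ∸ toℕ a)) mod N)
    (λ c → Fin.toℕ-injective (inverse _ c (add-sub c)))
    (λ c → Fin.toℕ-injective (inverse′ c))
    where
    open ≡.≡-Reasoning
    reduce : ∀ x y → (x ℕ.+ y % N) % N ≡ (x ℕ.+ y) % N
    reduce x y = begin
      (x ℕ.+ y % N) % N          ≡⟨ %-distribˡ-+ x (y % N) N ⟩
      (x % N ℕ.+ y % N % N) % N  ≡⟨ ≡.cong (λ z → (x % N ℕ.+ z) % N) (m%n%n≡m%n y N) ⟩
      (x % N ℕ.+ y % N) % N      ≡⟨ %-distribˡ-+ x y N ⟨
      (x ℕ.+ y) % N              ∎
    wrap : ∀ (c : Fin N) → (toℕ c ℕ.+ N) % N ≡ toℕ c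
    wrap c = ≡.trans ([m+n]%n≡m%n (toℕ c) N) (m<n⇒m%n≡m (Fin.toℕ<n c))
    a≤N : toℕ a ℕ.≤ N
    a≤N = ℕ.<⇒≤ (Fin.toℕ<n a)
    add-sub : ∀ (c : Fin N) → toℕ a ℕ.+ (toℕ c ℕ.+ (N ∸ toℕ a)) ≡ toℕ c ℕ.+ N
    add-sub c = begin
      toℕ a ℕ.+ (toℕ c ℕ.+ (N ∸ toℕ a))  ≡⟨ ℕ.+-comm (toℕ a) _ ⟩
      toℕ c ℕ.+ (N ∸ toℕ a) ℕ.+ toℕ a    ≡⟨ ℕ.+-assoc (toℕ c) _ _ ⟩
      toℕ c ℕ.+ ((N ∸ toℕ a) ℕ.+ toℕ a)  ≡⟨ ≡.cong (toℕ c ℕ.+_) (ℕ.m∸n+n≡m a≤N) ⟩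
      toℕ c ℕ.+ N                        ∎
    inverse : ∀ x (c : Fin N) → toℕ a ℕ.+ x ≡ toℕ c ℕ.+ N → toℕ (a ⊕ (x mod N)) ≡ toℕ c
    inverse x c eq = begin
      toℕ (a ⊕ (x mod N))           ≡⟨ toℕ-⊕ a (x mod N) ⟩
      (toℕ a ℕ.+ toℕ (x mod N)) % N ≡⟨ ≡.cong (λ y → (toℕ a ℕ.+ y) % N) (Fin.toℕ-fromℕ< (m%n<n x N)) ⟩
      (toℕ a ℕ.+ x % N) % N         ≡⟨ reduce (toℕ a) x ⟩
      (toℕ a ℕ.+ x) % N             ≡⟨ ≡.cong (_% N) eq ⟩
      (toℕ c ℕ.+ N) % N             ≡⟨ wrap c ⟩
      toℕ c                         ∎
    inverse′ : ∀ (c : Fin N) → toℕ ((toℕ (a ⊕ c) ℕ.+ (N ∸ toℕ a)) mod N) ≡ toℕ c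
    inverse′ c = begin
      toℕ ((toℕ (a ⊕ c) ℕ.+ (N ∸ toℕ a)) mod N)      ≡⟨ Fin.toℕ-fromℕ< (m%n<n _ N) ⟩
      (toℕ (a ⊕ c) ℕ.+ (N ∸ toℕ a)) % N              ≡⟨ ≡.cong (_% N) (ℕ.+-comm (toℕ (a ⊕ c)) _) ⟩
      ((N ∸ toℕ a) ℕ.+ toℕ (a ⊕ c)) % N              ≡⟨ ≡.cong (λ y → ((N ∸ toℕ a) ℕ.+ y) % N) (toℕ-⊕ a c) ⟩
      ((N ∸ toℕ a) ℕ.+ (toℕ a ℕ.+ toℕ c) % N) % N    ≡⟨ reduce (N ∸ toℕ a) _ ⟩
      ((N ∸ toℕ a) ℕ.+ (toℕ a ℕ.+ toℕ c)) % N        ≡⟨ ≡.cong (_% N) (ℕ.+-assoc (N ∸ toℕ a) _ _) ⟨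
      ((N ∸ toℕ a) ℕ.+ toℕ a ℕ.+ toℕ c) % N          ≡⟨ ≡.cong (λ y → (y ℕ.+ toℕ c) % N) (ℕ.m∸n+n≡m a≤N) ⟩
      (N ℕ.+ toℕ c) % N                              ≡⟨ ≡.cong (_% N) (ℕ.+-comm N _) ⟩
      (toℕ c ℕ.+ N) % N                              ≡⟨ wrap c ⟩
      toℕ c                                          ∎

  multiple? : ℕ → Fin N → Bool
  multiple? d a = does (d ∣? toℕ a)

  -- Since d divides N, subtracting N at a carry does not affect divisibility by d: the multiples of
  -- d form a subgroup, and translation by one of its elements respects membership.
  multiple?-⊕ : d ∣ N → ∀ (a b : Fin N) → d ∣ toℕ a → multiple? d (a ⊕ b) ≡ multiple? d b
  multiple?-⊕ {d} d∣N a b d∣a = does-⇔ (mk⇔ to from) (d ∣? _) (d ∣? _)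
    where
    to : d ∣ toℕ (a ⊕ b) → d ∣ toℕ b
    to d∣c with ⊕-cases a b
    ... | inj₁ eq = ∣m+n∣m⇒∣n (≡.subst (d ∣_) eq d∣c) d∣a
    ... | inj₂ eq = ∣m+n∣m⇒∣n (≡.subst (d ∣_) eq (∣m∣n⇒∣m+n d∣c d∣N)) d∣a
    from : d ∣ toℕ b → d ∣ toℕ (a ⊕ b)
    from d∣b with ⊕-cases a b
    ... | inj₁ eq = ≡.subst (d ∣_) (≡.sym eq) (∣m∣n⇒∣m+n d∣a d∣b)
    ... | inj₂ eq = ∣m+n∣m⇒∣n (≡.subst (d ∣_) (≡.sym (≡.trans (ℕ.+-comm N _) eq)) (∣m∣n⇒∣m+n d∣a d∣b)) d∣N

-- Finite sums with Boolean guards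

module Sums {c ℓ} (M : CommutativeMonoid c ℓ) where

  open CommutativeMonoid M renaming (_∙_ to _+_; ε to 0#; ∙-cong to +-cong; ∙-congˡ to +-congˡ)
  open Sum M
  open SetoidReasoning setoid

  private variable
    n : ℕ

  infixr 5 _⇒_

  -- A sum over a subset is encoded as a sum over all of `Fin n` with guarded terms, so that
  -- permutations of `Fin n` and exchange of sums apply directly.
  _⇒_ : Bool → Carrier → Carrier
  p ⇒ x = if p then x else 0#

  ⇒-cong : ∀ p {x y} → x ≈ y → p ⇒ x ≈ p ⇒ y
  ⇒-cong true  x≈y = x≈y
  ⇒-cong false _   = refl

  ⇒-distrib-+ : ∀ p x y → p ⇒ (x + y) ≈ (p ⇒ x) + (p ⇒ y)
  ⇒-distrib-+ true  x y = refl
  ⇒-distrib-+ false x y = sym (identityˡ 0#)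

  ⇒-comm : ∀ p q x → p ⇒ q ⇒ x ≈ q ⇒ p ⇒ x
  ⇒-comm true  q     x = refl
  ⇒-comm false true  x = refl
  ⇒-comm false false x = refl

  ⇒-sum : ∀ p (t : Fin n → Carrier) → ∑[ i < n ] (p ⇒ t i) ≈ p ⇒ ∑[ i < n ] t i
  ⇒-sum     true  t = refl
  ⇒-sum {n} false t = sum-replicate-zero n

  sum-zero : {t : Fin n → Carrier} → (∀ i → t i ≈ 0#) → sum t ≈ 0#
  sum-zero {n} t≈0 = trans (sum-cong-≋ t≈0) (sum-replicate-zero n)

  sum-single : ∀ (i : Fin n) {t} → (∀ j → i ≢ j → t j ≈ 0#) → sum t ≈ t i
  sum-single {suc n} i {t} t≈0 = begin
    sum t                        ≈⟨ sum-remove {i = i} t ⟩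
    t i + sum (removeAt t i)     ≈⟨ +-congˡ (sum-zero (λ j → t≈0 (punchIn i j) (Fin.punchInᵢ≢i i j ∘ ≡.sym))) ⟩
    t i + 0#                     ≈⟨ identityʳ (t i) ⟩
    t i                          ∎

-- The system without λ, over an abelian group

module Solver {c ℓ} (G : AbelianGroup c ℓ) {N : ℕ} .{{_ : NonZero N}}
  (f g : Fin N → AbelianGroup.Carrier G) where

  open AbelianGroup G
    renaming ( _∙_ to _+_; ε to 0#; assoc to +-assoc; comm to +-comm
             ; ∙-cong to +-cong; ∙-congˡ to +-congˡ; ∙-congʳ to +-congʳ)
  open AbelianGroupProperties G using (∙-cancelˡ; ∙-cancelʳ; //-rightDividesˡ; x≈z//y; //-cong₂)
  open CommutativeMonoidSolver commutativeMonoid using (solve; _⊜_) renaming (_⊕_ to _:+_)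
  open Sum commutativeMonoid
  open Sums commutativeMonoid
  open SetoidReasoning setoid

  Family : Set c
  Family = Fin N → Fin N → Carrier

  -- The equation γ(a,a) - λ(a,a) = g(a) is doubled to take the shape of the off-diagonal ones,
  -- which contain 2λ. This is its doubled right-hand side.
  diagonalTerm : Family
  diagonalTerm a b = does (a Fin.≟ b) ⇒ (g a + g a)

  lhs rhs : Family → Family
  lhs γ a b = γ (a ⊕ b) a + γ (a ⊕ b) b + diagonalTerm a b
  rhs γ a b = γ a b + γ b a + (f a + f b)

  Solves : Family → Set ℓ
  Solves γ = ∀ a b → lhs γ a b ≈ rhs γ a b

  diagonalTerm-≡ : ∀ a → diagonalTerm a a ≈ g a + g a
  diagonalTerm-≡ a with a Fin.≟ a
  ... | yes _  = refl
  ... | no a≢a = contradiction ≡.refl a≢a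

  diagonalTerm-≢ : ∀ {a b} → a ≢ b → diagonalTerm a b ≈ 0#
  diagonalTerm-≢ {a} {b} a≢b with a Fin.≟ b
  ... | yes a≡b = contradiction a≡b a≢b
  ... | no _    = refl

  lhs-≢ : ∀ γ {a b} → a ≢ b → lhs γ a b ≈ γ (a ⊕ b) a + γ (a ⊕ b) b
  lhs-≢ γ a≢b = trans (+-congˡ (diagonalTerm-≢ a≢b)) (identityʳ _)

  solves-by-cases : ∀ {γ} → (∀ a b → a ≢ b → γ (a ⊕ b) a + γ (a ⊕ b) b ≈ rhs γ a b) →
                    (∀ a → γ (a ⊕ a) a + γ (a ⊕ a) a + (g a + g a) ≈ rhs γ a a) → Solves γ
  solves-by-cases {γ} off diag a b = by-cases (a Fin.≟ b)
    where
    by-cases : Dec (a ≡ b) → lhs γ a b ≈ rhs γ a b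
    by-cases (yes ≡.refl) = trans (+-congˡ (diagonalTerm-≡ a)) (diag a)
    by-cases (no a≢b)     = trans (lhs-≢ γ a≢b) (off a b a≢b)

  lhs-sym : ∀ γ a b → lhs γ a b ≈ lhs γ b a
  lhs-sym γ a b with a Fin.≟ b
  ... | yes ≡.refl = sym (+-congˡ (diagonalTerm-≡ a))
  ... | no a≢b     = begin
    γ (a ⊕ b) a + γ (a ⊕ b) b + 0#  ≈⟨ identityʳ _ ⟩
    γ (a ⊕ b) a + γ (a ⊕ b) b       ≈⟨ +-comm _ _ ⟩
    γ (a ⊕ b) b + γ (a ⊕ b) a       ≡⟨ ≡.cong (λ e → γ e b + γ e a) (⊕-comm a b) ⟩
    γ (b ⊕ a) b + γ (b ⊕ a) a       ≈⟨ lhs-≢ γ (a≢b ∘ ≡.sym) ⟨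
    lhs γ b a                       ∎

  rhs-sym : ∀ γ a b → rhs γ a b ≈ rhs γ b a
  rhs-sym γ a b = +-cong (+-comm _ _) (+-comm _ _)

  -- For a < b the equation at (a , b) expresses γ a b through γ b a and the
  -- values at (a ⊕ b , a) and (a ⊕ b , b): either a ⊕ b < a, or a ⊕ b ≥ b and
  -- both values are prescribed.  Hence the first argument is a bound on the
  -- depth of the recursion.
  extendBy : ℕ → Family → Family
  extendBy zero    U a b = 0#
  extendBy (suc n) U a b with toℕ b ℕ.≤? toℕ a
  ... | yes _ = U a b
  ... | no  _ = (extendBy n U (a ⊕ b) a + extendBy n U (a ⊕ b) b) - (U b a + (f a + f b))

  -- From (a , b) there are at most toℕ a + 1, hence at most N, recursive steps. One more unit is
  -- spent on reading a prescribed value instead of the default `0#`.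
  extend : Family → Family
  extend = extendBy (suc N)

  extendBy-≥ : ∀ n U {a b} → toℕ b ℕ.≤ toℕ a → extendBy (suc n) U a b ≡ U a b
  extendBy-≥ n U {a} {b} b≤a with toℕ b ℕ.≤? toℕ a
  ... | yes _  = ≡.refl
  ... | no b≰a = contradiction b≤a b≰a

  -- The bound only matters where a < b. A step from there either carries, and the first coordinate
  -- drops, or lands on prescribed values; so the bound and the first coordinate decrease together.
  extendBy-suc : ∀ n U a b → (toℕ a ℕ.< toℕ b → toℕ a ℕ.< n) →
                 extendBy (suc n) U a b ≡ extendBy (suc (suc n)) U a b
  extendBy-suc n U a b a<n with toℕ b ℕ.≤? toℕ a
  ... | yes _  = ≡.refl
  extendBy-suc zero    U a b a<0 | no b≰a = contradiction (a<0 (ℕ.≰⇒> b≰a)) ℕ.n≮0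
  extendBy-suc (suc n) U a b a<1+n | no b≰a =
    ≡.cong₂ (λ x y → (x + y) - (U b a + (f a + f b)))
      (extendBy-suc n U (a ⊕ b) a (λ c<a → ℕ.<-≤-trans c<a a≤n))
      (extendBy-suc n U (a ⊕ b) b c<b⇒c<n)
    where
    a≤n : toℕ a ℕ.≤ n
    a≤n = ℕ.s≤s⁻¹ (a<1+n (ℕ.≰⇒> b≰a))
    c<b⇒c<n : toℕ (a ⊕ b) ℕ.< toℕ b → toℕ (a ⊕ b) ℕ.< n
    c<b⇒c<n c<b with ⊕-cases a b
    ... | inj₁ eq = contradiction (no-carry⇒≥ʳ eq) (ℕ.<⇒≱ c<b)
    ... | inj₂ eq = ℕ.<-≤-trans (carry⇒<ˡ eq) a≤n

  extend-≥ : ∀ U {a b} → toℕ b ℕ.≤ toℕ a → extend U a b ≡ U a b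
  extend-≥ = extendBy-≥ N

  extend-< : ∀ U {a b} → toℕ a ℕ.< toℕ b →
             extend U a b ≡ (extend U (a ⊕ b) a + extend U (a ⊕ b) b) - (U b a + (f a + f b))
  extend-< U {a} {b} a<b = ≡.trans (extendBy-suc N U a b (λ _ → Fin.toℕ<n a)) unfold
    where
    unfold : extendBy (suc (suc N)) U a b ≡ (extend U (a ⊕ b) a + extend U (a ⊕ b) b) - (U b a + (f a + f b))
    unfold with toℕ b ℕ.≤? toℕ a
    ... | yes b≤a = contradiction b≤a (ℕ.<⇒≱ a<b)
    ... | no _    = ≡.refl

  extend-solves-< : ∀ U {a b} → toℕ a ℕ.< toℕ b → lhs (extend U) a b ≈ rhs (extend U) a b
  extend-solves-< U {a} {b} a<b = begin
    lhs γ a b                                    ≈⟨ lhs-≢ γ (ℕ.<⇒≢ a<b ∘ ≡.cong toℕ) ⟩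
    γ (a ⊕ b) a + γ (a ⊕ b) b                    ≈⟨ //-rightDividesˡ _ _ ⟨
    ((γ (a ⊕ b) a + γ (a ⊕ b) b) - r) + r        ≡⟨ ≡.cong (_+ r) (extend-< U a<b) ⟨
    γ a b + (U b a + (f a + f b))                ≡⟨ ≡.cong (λ x → γ a b + (x + (f a + f b))) (extend-≥ U (ℕ.<⇒≤ a<b)) ⟨
    γ a b + (γ b a + (f a + f b))                ≈⟨ +-assoc _ _ _ ⟨
    rhs γ a b                                    ∎
    where
    γ = extend U
    r = U b a + (f a + f b)

  extend-solves-≢ : ∀ U {a b} → a ≢ b → lhs (extend U) a b ≈ rhs (extend U) a b
  extend-solves-≢ U {a} {b} a≢b with ℕ.<-cmp (toℕ a) (toℕ b)
  ... | tri< a<b _ _ = extend-solves-< U a<b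
  ... | tri≈ _ a≡b _ = contradiction (Fin.toℕ-injective a≡b) a≢b
  ... | tri> _ _ b<a = trans (lhs-sym (extend U) a b) (trans (extend-solves-< U b<a) (rhs-sym (extend U) b a))

  extend-solves : ∀ U a b → (a ≡ b → lhs (extend U) a a ≈ rhs (extend U) a a) → Dec (a ≡ b) →
                  lhs (extend U) a b ≈ rhs (extend U) a b
  extend-solves U a b diag (yes ≡.refl) = diag ≡.refl
  extend-solves U a b diag (no a≢b)     = extend-solves-≢ U a≢b

  -- The value at (a , b) only depends on diagonal data if gcd (N - a , N - b)
  -- divides N: negation turns the recursion into (x , y) ↦ (x + y , x) , (x + y , y),
  -- which preserves common divisors, and the diagonal is reached at x = N.
  extendBy-cong : ∀ {U U′} d →
    (∀ a b → toℕ b ℕ.< toℕ a → U a b ≈ U′ a b) → (d ∣ N → ∀ a → U a a ≈ U′ a a) →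
    ∀ n a b → (toℕ a ℕ.≤ toℕ b → d ∣ N ∸ toℕ a × d ∣ N ∸ toℕ b × (a ≡ b → d ∣ N)) →
    extendBy n U a b ≈ extendBy n U′ a b
  extendBy-cong d low diag zero a b h = refl
  extendBy-cong {U} {U′} d low diag (suc n) a b h with toℕ b ℕ.≤? toℕ a
  ... | yes b≤a with a Fin.≟ b
  ...   | yes ≡.refl = diag (proj₂ (proj₂ (h b≤a)) ≡.refl) a
  ...   | no a≢b     = low a b (ℕ.≤∧≢⇒< b≤a (a≢b ∘ ≡.sym ∘ Fin.toℕ-injective))
  extendBy-cong {U} {U′} d low diag (suc n) a b h | no b≰a =
    //-cong₂ (+-cong (extendBy-cong d low diag n (a ⊕ b) a hˡ) (extendBy-cong d low diag n (a ⊕ b) b hʳ))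
             (+-congʳ (low b a a<b))
    where
    a<b : toℕ a ℕ.< toℕ b
    a<b = ℕ.≰⇒> b≰a
    d∣-a : d ∣ N ∸ toℕ a
    d∣-a = proj₁ (h (ℕ.<⇒≤ a<b))
    d∣-b : d ∣ N ∸ toℕ b
    d∣-b = proj₁ (proj₂ (h (ℕ.<⇒≤ a<b)))
    carried : toℕ (a ⊕ b) ℕ.+ N ≡ toℕ a ℕ.+ toℕ b → d ∣ N ∸ toℕ (a ⊕ b)
    carried eq = ≡.subst (d ∣_) (≡.sym (carry⇒neg {a = a} {b} eq)) (∣m∣n⇒∣m+n d∣-a d∣-b)
    hˡ : toℕ (a ⊕ b) ℕ.≤ toℕ a → d ∣ N ∸ toℕ (a ⊕ b) × d ∣ N ∸ toℕ a × (a ⊕ b ≡ a → d ∣ N)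
    hˡ c≤a with ⊕-cases a b
    ... | inj₁ eq = contradiction (ℕ.≤-trans (no-carry⇒≥ʳ {a = a} eq) c≤a) b≰a
    ... | inj₂ eq = carried eq , d∣-a , λ c≡a → contradiction (≡.cong toℕ c≡a) (ℕ.<⇒≢ (carry⇒<ˡ eq))
    hʳ : toℕ (a ⊕ b) ℕ.≤ toℕ b → d ∣ N ∸ toℕ (a ⊕ b) × d ∣ N ∸ toℕ b × (a ⊕ b ≡ b → d ∣ N)
    hʳ c≤b with ⊕-cases a b
    -- Without a carry, a ⊕ b ≤ b forces a = 0. The position is then (b , b), and d divides N - a =
    -- N.
    ... | inj₁ eq = ≡.subst (λ x → d ∣ N ∸ x) b≡c d∣-b , d∣-b , λ _ → ≡.subst (λ x → d ∣ N ∸ x) a≡0 d∣-a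
      where
      b≡c : toℕ b ≡ toℕ (a ⊕ b)
      b≡c = ℕ.≤-antisym (no-carry⇒≥ʳ {a = a} eq) c≤b
      a≡0 : toℕ a ≡ 0
      a≡0 = ℕ.+-cancelʳ-≡ (toℕ b) (toℕ a) 0 (≡.trans (≡.sym eq) (≡.sym b≡c))
    ... | inj₂ eq = carried eq , d∣-b ,
      λ c≡b → contradiction (≡.cong toℕ c≡b) (ℕ.<⇒≢ (ℕ.<-trans (carry⇒<ˡ eq) a<b))

  IsDivisor : Fin N → Set
  IsDivisor a = N ∸ toℕ a ∣ N

  -- With d = N - a, the negated coordinates of (a ⊕ a , a) are (2d , d) if a carry occurs. All
  -- pairs below it consist of multiples of d, so reaching the diagonal at x = N would make d a
  -- divisor of N.
  extend-cong-nondivisor : ∀ {U U′} → (∀ a b → toℕ b ℕ.< toℕ a → U a b ≈ U′ a b) →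
    ∀ a → ¬ IsDivisor a → extend U (a ⊕ a) a ≈ extend U′ (a ⊕ a) a
  extend-cong-nondivisor low a ∤N =
    extendBy-cong (N ∸ toℕ a) low (λ ∣N → contradiction ∣N ∤N) (suc N) (a ⊕ a) a h
    where
    h : toℕ (a ⊕ a) ℕ.≤ toℕ a →
        N ∸ toℕ a ∣ N ∸ toℕ (a ⊕ a) × N ∸ toℕ a ∣ N ∸ toℕ a × (a ⊕ a ≡ a → IsDivisor a)
    h c≤a with ⊕-cases a a
    -- Without a carry, a ⊕ a ≤ a only for a = 0, and N - 0 does divide N.
    ... | inj₁ eq = contradiction (≡.subst (λ x → N ∸ x ∣ N) (≡.sym a≡0) ∣-refl) ∤N
      where
      a≡0 : toℕ a ≡ 0
      a≡0 = ℕ.n≤0⇒n≡0 (ℕ.+-cancelʳ-≤ (toℕ a) (toℕ a) 0 (≡.subst (ℕ._≤ toℕ a) eq c≤a))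
    ... | inj₂ eq = ≡.subst (N ∸ toℕ a ∣_) (≡.sym (carry⇒neg {a = a} {a} eq)) (∣m∣n⇒∣m+n ∣-refl ∣-refl) , ∣-refl ,
      λ c≡a → contradiction (≡.cong toℕ c≡a) (ℕ.<⇒≢ (carry⇒<ˡ eq))

  AgreeOnFree : Family → Family → Set ℓ
  AgreeOnFree γ γ′ = (∀ a b → toℕ b ℕ.< toℕ a → γ a b ≈ γ′ a b)
                   × (∀ a → IsDivisor a → γ a a ≈ γ′ a a)

  private
    pair-up : ∀ u v w → (u + v) + (u + w) ≈ (u + u) + (v + w)
    pair-up = solve 3 (λ u v w → (u :+ v) :+ (u :+ w) ⊜ (u :+ u) :+ (v :+ w)) refl

  -- A solution is determined by its values at the free positions

  module Uniqueness (torsion-free : ∀ x y → x + x ≈ y + y → x ≈ y) where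

    solves-diagonal : ∀ {γ} → Solves γ → ∀ a → γ (a ⊕ a) a + g a ≈ γ a a + f a
    solves-diagonal {γ} sol a = torsion-free _ _ (begin
      (γ (a ⊕ a) a + g a) + (γ (a ⊕ a) a + g a)  ≈⟨ pair-up _ _ _ ⟩
      (γ (a ⊕ a) a + γ (a ⊕ a) a) + (g a + g a)  ≈⟨ +-congˡ (diagonalTerm-≡ a) ⟨
      lhs γ a a                                  ≈⟨ sol a a ⟩
      (γ a a + γ a a) + (f a + f a)              ≈⟨ pair-up _ _ _ ⟨
      (γ a a + f a) + (γ a a + f a)              ∎)

    -- A solution satisfies the recursion behind `extendBy`, hence is the extension of its own
    -- values. Comparing two solutions thus reduces to comparing their data on and below the
    -- diagonal.
    solves⇒extendBy : ∀ {γ} → Solves γ → ∀ n a b → (toℕ a ℕ.< toℕ b → toℕ a ℕ.< n) →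
                      extendBy (suc n) γ a b ≈ γ a b
    solves⇒extendBy sol n a b a<n with toℕ b ℕ.≤? toℕ a
    ... | yes _ = refl
    solves⇒extendBy sol zero    a b a<0   | no b≰a = contradiction (a<0 (ℕ.≰⇒> b≰a)) ℕ.n≮0
    solves⇒extendBy {γ} sol (suc n) a b a<1+n | no b≰a = begin
      (extendBy (suc n) γ (a ⊕ b) a + extendBy (suc n) γ (a ⊕ b) b) - r
        ≈⟨ +-congʳ (+-cong (solves⇒extendBy sol n (a ⊕ b) a (λ c<a → ℕ.<-≤-trans c<a a≤n))
                           (solves⇒extendBy sol n (a ⊕ b) b c<b⇒c<n)) ⟩
      (γ (a ⊕ b) a + γ (a ⊕ b) b) - r
        ≈⟨ x≈z//y _ _ _ (trans (sym (+-assoc _ _ _))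
             (trans (sym (sol a b)) (lhs-≢ γ (λ a≡b → b≰a (ℕ.≤-reflexive (≡.cong toℕ (≡.sym a≡b))))))) ⟨
      γ a b ∎
      where
      r = γ b a + (f a + f b)
      a≤n : toℕ a ℕ.≤ n
      a≤n = ℕ.s≤s⁻¹ (a<1+n (ℕ.≰⇒> b≰a))
      c<b⇒c<n : toℕ (a ⊕ b) ℕ.< toℕ b → toℕ (a ⊕ b) ℕ.< n
      c<b⇒c<n c<b with ⊕-cases a b
      ... | inj₁ eq = contradiction (no-carry⇒≥ʳ {a = a} eq) (ℕ.<⇒≱ c<b)
      ... | inj₂ eq = ℕ.<-≤-trans (carry⇒<ˡ eq) a≤n

    solves⇒extend : ∀ {γ} → Solves γ → ∀ a b → extend γ a b ≈ γ a b
    solves⇒extend sol a b = solves⇒extendBy sol N a b (λ _ → Fin.toℕ<n a)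

    unique : ∀ {γ γ′} → Solves γ → Solves γ′ → AgreeOnFree γ γ′ → ∀ a b → γ a b ≈ γ′ a b
    unique {γ} {γ′} sol sol′ (low , divisor) a b = begin
      γ a b          ≈⟨ solves⇒extend sol a b ⟨
      -- For d = 1 the divisibility conditions are void; the whole diagonal is already known to
      -- agree by `diag`.
      extend γ a b   ≈⟨ extendBy-cong 1 low (λ _ → diag) (suc N) a b (λ _ → 1∣ _ , 1∣ _ , λ _ → 1∣ _) ⟩
      extend γ′ a b  ≈⟨ solves⇒extend sol′ a b ⟩
      γ′ a b         ∎
      where
      diag : ∀ a → γ a a ≈ γ′ a a
      diag a with (N ∸ toℕ a) ∣? N
      ... | yes ∣N = divisor a ∣N
      -- Half of E(a , a) gives γ(a,a) in terms of γ(a ⊕ a,a), which here depends only on values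
      -- below the diagonal.
      ... | no ∤N  = ∙-cancelʳ (f a) _ _ (begin
        γ a a + f a                    ≈⟨ solves-diagonal sol a ⟨
        γ (a ⊕ a) a + g a              ≈⟨ +-congʳ (solves⇒extend sol (a ⊕ a) a) ⟨
        extend γ (a ⊕ a) a + g a       ≈⟨ +-congʳ (extend-cong-nondivisor low a ∤N) ⟩
        extend γ′ (a ⊕ a) a + g a      ≈⟨ +-congʳ (solves⇒extend sol′ (a ⊕ a) a) ⟩
        γ′ (a ⊕ a) a + g a             ≈⟨ solves-diagonal sol′ a ⟩
        γ′ a a + f a                   ∎)

  -- Construction of a solution from prescribed values

  -- Half of E(a , a), solved for γ(a,a), at the non-divisors. Using `extend φ` with the arbitrary
  -- diagonal of φ is harmless, since the value at (a ⊕ a , a) reads no diagonal entry in this case;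
  -- so all entries are filled in at once, without an order among them.
  complete : Family → Family
  complete φ a b with a Fin.≟ b | (N ∸ toℕ a) ∣? N
  ... | yes _ | no _ = (extend φ (a ⊕ a) a + g a) - f a
  ... | _     | _    = φ a b

  complete-≢ : ∀ φ {a b} → a ≢ b → complete φ a b ≡ φ a b
  complete-≢ φ {a} {b} a≢b with a Fin.≟ b | (N ∸ toℕ a) ∣? N
  ... | yes a≡b | _     = contradiction a≡b a≢b
  ... | no _    | yes _ = ≡.refl
  ... | no _    | no _  = ≡.refl

  complete-divisor : ∀ φ {a} → IsDivisor a → complete φ a a ≡ φ a a
  complete-divisor φ {a} ∣N with a Fin.≟ a | (N ∸ toℕ a) ∣? N
  ... | yes _ | yes _ = ≡.refl
  ... | yes _ | no ∤N = contradiction ∣N ∤N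
  ... | no _  | _     = ≡.refl

  complete-nondivisor : ∀ φ {a} → ¬ IsDivisor a → complete φ a a ≡ (extend φ (a ⊕ a) a + g a) - f a
  complete-nondivisor φ {a} ∤N with a Fin.≟ a | (N ∸ toℕ a) ∣? N
  ... | yes _  | yes ∣N = contradiction ∣N ∤N
  ... | yes _  | no _   = ≡.refl
  ... | no a≢a | _      = contradiction ≡.refl a≢a

  solution : Family → Family
  solution φ = extend (complete φ)

  solution-agrees : ∀ φ → AgreeOnFree (solution φ) φ
  solution-agrees φ =
    (λ a b b<a → reflexive (≡.trans (extend-≥ (complete φ) (ℕ.<⇒≤ b<a))
      (complete-≢ φ (ℕ.<⇒≢ b<a ∘ ≡.cong toℕ ∘ ≡.sym)))) ,
    (λ a ∣N → reflexive (≡.trans (extend-≥ (complete φ) {a} {a} ℕ.≤-refl) (complete-divisor φ ∣N)))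

  solution-solves-nondivisor : ∀ φ a → ¬ IsDivisor a → lhs (solution φ) a a ≈ rhs (solution φ) a a
  solution-solves-nondivisor φ a ∤N = begin
    (γ (a ⊕ a) a + γ (a ⊕ a) a) + diagonalTerm a a  ≈⟨ +-congˡ (diagonalTerm-≡ a) ⟩
    (γ (a ⊕ a) a + γ (a ⊕ a) a) + (g a + g a)       ≈⟨ pair-up _ _ _ ⟨
    (γ (a ⊕ a) a + g a) + (γ (a ⊕ a) a + g a)       ≈⟨ +-cong half half ⟩
    (γ a a + f a) + (γ a a + f a)                   ≈⟨ pair-up _ _ _ ⟩
    rhs γ a a                                       ∎
    where
    γ = solution φ
    half : γ (a ⊕ a) a + g a ≈ γ a a + f a
    half = begin
      γ (a ⊕ a) a + g a                        ≈⟨ +-congʳ (extend-cong-nondivisor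
        (λ a b b<a → reflexive (complete-≢ φ (ℕ.<⇒≢ b<a ∘ ≡.cong toℕ ∘ ≡.sym))) a ∤N) ⟩
      extend φ (a ⊕ a) a + g a                 ≈⟨ //-rightDividesˡ (f a) _ ⟨
      ((extend φ (a ⊕ a) a + g a) - f a) + f a ≡⟨ ≡.cong (_+ f a)
        (≡.trans (extend-≥ (complete φ) {a} {a} ℕ.≤-refl) (complete-nondivisor φ ∤N)) ⟨
      γ a a + f a                              ∎

  -- The construction uses nothing but group operations on f, g and the prescribed values, so it
  -- stays inside any subgroup containing them. The subgroup intended is the span of f and g.
  module Closure {p} (P : Pred Carrier p)
    (0∈ : P 0#) (+-closed : ∀ {x y} → P x → P y → P (x + y)) (-‿closed : ∀ {x} → P x → P (x ⁻¹))
    (f∈ : ∀ a → P (f a)) (g∈ : ∀ a → P (g a)) where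

    extendBy-closed : ∀ {U} → (∀ a b → P (U a b)) → ∀ n a b → P (extendBy n U a b)
    extendBy-closed U∈ zero    a b = 0∈
    extendBy-closed U∈ (suc n) a b with toℕ b ℕ.≤? toℕ a
    ... | yes _ = U∈ a b
    ... | no _  = +-closed (+-closed (extendBy-closed U∈ n (a ⊕ b) a) (extendBy-closed U∈ n (a ⊕ b) b))
                           (-‿closed (+-closed (U∈ b a) (+-closed (f∈ a) (f∈ b))))

    complete-closed : ∀ {φ} → (∀ a b → P (φ a b)) → ∀ a b → P (complete φ a b)
    complete-closed φ∈ a b with a Fin.≟ b | (N ∸ toℕ a) ∣? N
    ... | yes _ | no _  = +-closed (+-closed (extendBy-closed φ∈ (suc N) (a ⊕ a) a) (g∈ a)) (-‿closed (f∈ a))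
    ... | yes _ | yes _ = φ∈ a b
    ... | no _  | yes _ = φ∈ a b
    ... | no _  | no _  = φ∈ a b

    solution-closed : ∀ {φ} → (∀ a b → P (φ a b)) → ∀ a b → P (solution φ a b)
    solution-closed φ∈ = extendBy-closed (complete-closed φ∈) (suc N)

  -- Summing the equations over the square of a subgroup

  sum-cancel : ∀ {n} (i : Fin n) {t u : Fin n → Carrier} →
               (∀ j → i ≢ j → t j ≈ u j) → sum t ≈ sum u → t i ≈ u i
  sum-cancel {suc n} i {t} {u} t≈u ∑t≈∑u = ∙-cancelʳ (sum (removeAt t i)) _ _ (begin
    t i + sum (removeAt t i)  ≈⟨ sum-remove {i = i} t ⟨
    sum t                     ≈⟨ ∑t≈∑u ⟩
    sum u                     ≈⟨ sum-remove {i = i} u ⟩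
    u i + sum (removeAt u i)  ≈⟨ +-congˡ (sum-cong-≋ (λ j → t≈u (punchIn i j) (Fin.punchInᵢ≢i i j ∘ ≡.sym))) ⟨
    u i + sum (removeAt t i)  ∎)

  ∑² : (Fin N → Bool) → Family → Carrier
  ∑² H F = ∑[ a < N ] ∑[ b < N ] (H a ⇒ H b ⇒ F a b)

  module _ (H : Fin N → Bool) where

    ∑²-distrib-+ : ∀ F F′ → ∑² H (λ a b → F a b + F′ a b) ≈ ∑² H F + ∑² H F′
    ∑²-distrib-+ F F′ = trans
      (sum-cong-≋ (λ a → trans
        (sum-cong-≋ (λ b → trans (⇒-cong (H a) (⇒-distrib-+ (H b) _ _)) (⇒-distrib-+ (H a) _ _)))
        (∑-distrib-+ (λ b → H a ⇒ H b ⇒ F a b) (λ b → H a ⇒ H b ⇒ F′ a b))))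
      (∑-distrib-+ (λ a → ∑[ b < N ] (H a ⇒ H b ⇒ F a b)) (λ a → ∑[ b < N ] (H a ⇒ H b ⇒ F′ a b)))

    ∑²-flip : ∀ F → ∑² H (λ a b → F b a) ≈ ∑² H F
    ∑²-flip F = trans
      (sum-cong-≋ (λ a → sum-cong-≋ (λ b → ⇒-comm (H a) (H b) (F b a))))
      (∑-comm (λ a b → H b ⇒ H a ⇒ F b a))

    ∑²-diagonalTerm : ∑² H diagonalTerm ≈ ∑[ a < N ] (H a ⇒ g a + g a)
    ∑²-diagonalTerm = sum-cong-≋ (λ a → trans
      (sum-single a (λ b a≢b → trans (⇒-cong (H a) (⇒-cong (H b) (diagonalTerm-≢ a≢b))) (off a b)))
      (on a))
      where
      off : ∀ a b → H a ⇒ H b ⇒ 0# ≈ 0#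
      off a b with H a | H b
      ... | true  | true  = refl
      ... | true  | false = refl
      ... | false | _     = refl
      on : ∀ a → H a ⇒ H a ⇒ diagonalTerm a a ≈ H a ⇒ g a + g a
      on a with H a
      ... | true  = diagonalTerm-≡ a
      ... | false = refl

    ∑²-shift : (∀ a b → H a ≡ true → H (a ⊕ b) ≡ H b) → ∀ F → ∑² H (λ a b → F (a ⊕ b) a) ≈ ∑² H F
    -- Under the guard `H a` the guard of b may be replaced by that of a ⊕ b; then c = a ⊕ b is the
    -- new summation variable.
    ∑²-shift H-⊕ F = trans (sum-cong-≋ (λ a → trans
      (sum-cong-≋ (λ b → ⇒-cong-true (H a) (λ Ha → reflexive (≡.cong (_⇒ F (a ⊕ b) a) (≡.sym (H-⊕ a b Ha))))))
      (sym (∑-permute (λ c → H a ⇒ H c ⇒ F c a) (⊕-permutation a)))))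
      (∑²-flip F)
      where
      ⇒-cong-true : ∀ p {x y} → (p ≡ true → x ≈ y) → p ⇒ x ≈ p ⇒ y
      ⇒-cong-true true  x≈y = x≈y ≡.refl
      ⇒-cong-true false _   = refl

    -- This turns a dependency among the equations on H × H into a derivation of the one at (i , i)
    -- from the others. Cancellation is applied first to the rows, then inside row i.
    ∑²-cancel : ∀ {F F′} i → H i ≡ true →
      (∀ a b → H a ≡ true → H b ≡ true → ¬ (i ≡ a × i ≡ b) → F a b ≈ F′ a b) →
      ∑² H F ≈ ∑² H F′ → F i i ≈ F′ i i
    ∑²-cancel {F} {F′} i Hi F≈F′ eq =
      ≡.subst (λ p → p ⇒ p ⇒ F i i ≈ p ⇒ p ⇒ F′ i i) Hi
        (sum-cancel i (λ b i≢b → agree i b (i≢b ∘ proj₂))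
          (sum-cancel i (λ a i≢a → sum-cong-≋ (λ b → agree a b (i≢a ∘ proj₁))) eq))
      where
      agree : ∀ a b → ¬ (i ≡ a × i ≡ b) → H a ⇒ H b ⇒ F a b ≈ H a ⇒ H b ⇒ F′ a b
      agree a b ¬i with H a in Ha | H b in Hb
      ... | true  | true  = F≈F′ a b Ha Hb ¬i
      ... | true  | false = refl
      ... | false | _     = refl

  -- The second summation variable on the left does not occur in the term: summing over it expresses
  -- the factor |H| without integer multiples.
  DistributionRelation : Set ℓ
  DistributionRelation = ∀ d → d ∣ N →
    ∑² (multiple? d) (λ a _ → f a) ≈ ∑[ a < N ] (multiple? d a ⇒ g a)

  module Existence (distribution : DistributionRelation) where

    -- On a subgroup H of ℤ/N the map b ↦ a ⊕ b permutes H for every a ∈ H, so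
    -- all γ-terms cancel in the sum of the equations over H × H.
    ∑²-lhs≈∑²-rhs : ∀ d → d ∣ N → ∀ γ → ∑² (multiple? d) (lhs γ) ≈ ∑² (multiple? d) (rhs γ)
    ∑²-lhs≈∑²-rhs d d∣N γ = begin
      ∑² H (lhs γ)
        ≈⟨ ∑²-distrib-+ H (λ a b → γ (a ⊕ b) a + γ (a ⊕ b) b) diagonalTerm ⟩
      ∑² H (λ a b → γ (a ⊕ b) a + γ (a ⊕ b) b) + ∑² H diagonalTerm
        ≈⟨ +-cong (∑²-distrib-+ H (λ a b → γ (a ⊕ b) a) (λ a b → γ (a ⊕ b) b)) ∑-diagonal ⟩
      (∑² H (λ a b → γ (a ⊕ b) a) + ∑² H (λ a b → γ (a ⊕ b) b)) + (∑² H (λ a _ → f a) + ∑² H (λ _ b → f b))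
        ≈⟨ +-congʳ (+-cong shiftˡ shiftʳ) ⟩
      (∑² H γ + ∑² H (λ a b → γ b a)) + (∑² H (λ a _ → f a) + ∑² H (λ _ b → f b))
        ≈⟨ +-cong (∑²-distrib-+ H γ (λ a b → γ b a)) (∑²-distrib-+ H (λ a _ → f a) (λ _ b → f b)) ⟨
      ∑² H (λ a b → γ a b + γ b a) + ∑² H (λ a b → f a + f b)
        ≈⟨ ∑²-distrib-+ H (λ a b → γ a b + γ b a) (λ a b → f a + f b) ⟨
      ∑² H (rhs γ) ∎
      where
      H : Fin N → Bool
      H = multiple? d
      H-⊕ : ∀ a b → H a ≡ true → H (a ⊕ b) ≡ H b
      H-⊕ a b Ha with d ∣? toℕ a
      ... | yes d∣a = multiple?-⊕ d∣N a b d∣a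
      shiftˡ : ∑² H (λ a b → γ (a ⊕ b) a) ≈ ∑² H γ
      shiftˡ = ∑²-shift H H-⊕ γ
      shiftʳ : ∑² H (λ a b → γ (a ⊕ b) b) ≈ ∑² H (λ a b → γ b a)
      shiftʳ = begin
        ∑² H (λ a b → γ (a ⊕ b) b)  ≈⟨ sum-cong-≋ (λ a → sum-cong-≋ (λ b → ⇒-cong (H a) (⇒-cong (H b)
                                          (reflexive (≡.cong (λ c → γ c b) (⊕-comm a b)))))) ⟩
        ∑² H (λ a b → γ (b ⊕ a) b)  ≈⟨ ∑²-flip H (λ a b → γ (a ⊕ b) a) ⟩
        ∑² H (λ a b → γ (a ⊕ b) a)  ≈⟨ shiftˡ ⟩
        ∑² H γ                      ≈⟨ ∑²-flip H γ ⟨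
        ∑² H (λ a b → γ b a)        ∎
      -- The g-terms add up to twice the sum of g over H, the f-terms to 2 |H| times the sum of f;
      -- the distribution relation is what balances them.
      ∑-diagonal : ∑² H diagonalTerm ≈ ∑² H (λ a _ → f a) + ∑² H (λ _ b → f b)
      ∑-diagonal = begin
        ∑² H diagonalTerm                                      ≈⟨ ∑²-diagonalTerm H ⟩
        ∑[ a < N ] (H a ⇒ g a + g a)                           ≈⟨ sum-cong-≋ (λ a → ⇒-distrib-+ (H a) (g a) (g a)) ⟩
        ∑[ a < N ] ((H a ⇒ g a) + (H a ⇒ g a))                 ≈⟨ ∑-distrib-+ (λ a → H a ⇒ g a) (λ a → H a ⇒ g a) ⟩
        ∑[ a < N ] (H a ⇒ g a) + ∑[ a < N ] (H a ⇒ g a)        ≈⟨ +-cong (distribution d d∣N) (distribution d d∣N) ⟨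
        ∑² H (λ a _ → f a) + ∑² H (λ a _ → f a)                ≈⟨ +-congˡ (∑²-flip H (λ a _ → f a)) ⟨
        ∑² H (λ a _ → f a) + ∑² H (λ _ b → f b)                ∎

    -- Strong induction on the representative. If d = N - a divides N, then d also divides a, and a
    -- is the largest multiple of d below N. On the square of the multiples of d the other diagonal
    -- equations hold by induction and the off-diagonal ones by construction, so the sum forces the
    -- one at a.
    solution-solves-diagonal : ∀ φ a → lhs (solution φ) a a ≈ rhs (solution φ) a a
    solution-solves-diagonal φ a = <-rec P step (toℕ a) a ≡.refl
      where
      P : ℕ → Set ℓ
      P k = ∀ a → toℕ a ≡ k → lhs (solution φ) a a ≈ rhs (solution φ) a a
      step : ∀ k → (∀ {j} → j ℕ.< k → P j) → P k
      step _ ih a ≡.refl with (N ∸ toℕ a) ∣? N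
      ... | no ∤N = solution-solves-nondivisor φ a ∤N
      ... | yes d∣N = ∑²-cancel (multiple? d) a (dec-true (d ∣? toℕ a) d∣a) others (∑²-lhs≈∑²-rhs d d∣N (solution φ))
        where
        d : ℕ
        d = N ∸ toℕ a
        d+ : ∀ (b : Fin N) → (N ∸ toℕ b) ℕ.+ toℕ b ≡ N
        d+ b = ℕ.m∸n+n≡m (ℕ.<⇒≤ (Fin.toℕ<n b))
        d∣a : d ∣ toℕ a
        d∣a = ∣m+n∣m⇒∣n (≡.subst (d ∣_) (≡.sym (d+ a)) d∣N) ∣-refl
        smaller : ∀ b → d ∣ toℕ b → a ≢ b → toℕ b ℕ.< toℕ a
        smaller b d∣b a≢b = ℕ.≤∧≢⇒< b≤a (a≢b ∘ ≡.sym ∘ Fin.toℕ-injective)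
          where
          d∣-b : d ∣ N ∸ toℕ b
          d∣-b = ∣m+n∣m⇒∣n (≡.subst (d ∣_) (≡.trans (≡.sym (d+ b)) (ℕ.+-comm (N ∸ toℕ b) (toℕ b))) d∣N) d∣b
          d≤-b : d ℕ.≤ N ∸ toℕ b
          d≤-b = ∣⇒≤ {{ℕ.>-nonZero (ℕ.m<n⇒0<n∸m (Fin.toℕ<n b))}} d∣-b
          b≤a : toℕ b ℕ.≤ toℕ a
          b≤a = ℕ.+-cancelˡ-≤ d _ _ (≡.subst (d ℕ.+ toℕ b ℕ.≤_) (≡.trans (d+ b) (≡.sym (d+ a))) (ℕ.+-monoˡ-≤ (toℕ b) d≤-b))
        others : ∀ b c → multiple? d b ≡ true → multiple? d c ≡ true → ¬ (a ≡ b × a ≡ c) →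
                 lhs (solution φ) b c ≈ rhs (solution φ) b c
        others b c Hb Hc ¬a = extend-solves (complete φ) b c below-a (b Fin.≟ c)
          where
          below-a : b ≡ c → lhs (solution φ) b b ≈ rhs (solution φ) b b
          below-a ≡.refl with d ∣? toℕ b
          ... | yes d∣b = ih (smaller b d∣b (λ a≡b → ¬a (a≡b , a≡b))) b ≡.refl

    solution-solves : ∀ φ → Solves (solution φ)
    solution-solves φ a b = extend-solves (complete φ) a b (λ _ → solution-solves-diagonal φ a) (a Fin.≟ b)

-- The number of free positions

module Counting where

  open import Data.Nat.Base using (_+_; _*_; _/_)
  open Sum ℕ.+-0-commutativeMonoid
  open Sums ℕ.+-0-commutativeMonoid using (sum-single; _⇒_)
  open ≡.≡-Reasoning

  length-filter-tabulate : ∀ {A : Set} {P : A → Set} (P? : Decidable P) {n} (t : Fin n → A) →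
    length (filter P? (tabulate t)) ≡ ∑[ i < n ] (does (P? (t i)) ⇒ 1)
  length-filter-tabulate P? {zero}  t = ≡.refl
  length-filter-tabulate P? {suc n} t with does (P? (t zero))
  ... | true  = ≡.cong suc (length-filter-tabulate P? (t ∘ suc))
  ... | false = length-filter-tabulate P? (t ∘ suc)

  length-filter-applyUpTo : ∀ {A : Set} {P : A → Set} (P? : Decidable P) (t : ℕ → A) n →
    length (filter P? (applyUpTo t n)) ≡ ∑[ i < n ] (does (P? (t (toℕ i))) ⇒ 1)
  length-filter-applyUpTo P? t zero = ≡.refl
  length-filter-applyUpTo P? t (suc n) with does (P? (t zero))
  ... | true  = ≡.cong suc (length-filter-applyUpTo P? (t ∘ suc) n)
  ... | false = length-filter-applyUpTo P? (t ∘ suc) n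

  length-filter-cartesianProduct : ∀ {A B : Set} {P : _ → Set} (P? : Decidable P)
    {m n} (s : Fin m → A) (t : Fin n → B) →
    length (filter P? (cartesianProduct (tabulate s) (tabulate t))) ≡
    ∑[ i < m ] ∑[ j < n ] (does (P? (s i , t j)) ⇒ 1)
  length-filter-cartesianProduct P? {zero}  s t = ≡.refl
  length-filter-cartesianProduct P? {suc m} s t = begin
    length (filter P? (row ++ rest))                   ≡⟨ ≡.cong length (filter-++ P? row rest) ⟩
    length (filter P? row ++ filter P? rest)           ≡⟨ length-++ (filter P? row) ⟩
    length (filter P? row) + length (filter P? rest)
      ≡⟨ ≡.cong₂ _+_ (≡.trans (≡.cong (length ∘ filter P?) (map-tabulate t (s zero ,_)))
                              (length-filter-tabulate P? (λ j → s zero , t j)))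
                     (length-filter-cartesianProduct P? (s ∘ suc) t) ⟩
    _ ∎
    where
    row = map (s zero ,_) (tabulate t)
    rest = cartesianProduct (tabulate (s ∘ suc)) (tabulate t)

  sum-<-indicator : ∀ {n k} → k ℕ.≤ n → ∑[ j < n ] (does (toℕ j ℕ.<? k) ⇒ 1) ≡ k
  sum-<-indicator {zero}  {zero}  z≤n       = ≡.refl
  sum-<-indicator {suc n} {zero}  z≤n       = sum-<-indicator {n} {zero} z≤n
  sum-<-indicator {suc n} {suc k} (s≤s k≤n) = ≡.cong suc (sum-<-indicator k≤n)

  sum-suc : ∀ {n} (t : Fin n → ℕ) → ∑[ i < n ] suc (t i) ≡ n + ∑[ i < n ] t i
  sum-suc {n} t = begin
    ∑[ i < n ] (1 + t i)          ≡⟨ ∑-distrib-+ (λ _ → 1) t ⟩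
    ∑[ i < n ] 1 + ∑[ i < n ] t i ≡⟨ ≡.cong (_+ ∑[ i < n ] t i) (ones n) ⟩
    n + ∑[ i < n ] t i            ∎
    where
    ones : ∀ n → ∑[ i < n ] 1 ≡ n
    ones zero    = ≡.refl
    ones (suc n) = ≡.cong suc (ones n)

  sum-toℕ : ∀ n → ∑[ i < n ] toℕ i ≡ n * (n ∸ 1) / 2
  sum-toℕ n = begin
    ∑[ i < n ] toℕ i           ≡⟨ m*n/n≡m _ 2 ⟨
    ∑[ i < n ] toℕ i * 2 / 2   ≡⟨ ≡.cong (_/ 2) (double n) ⟩
    n * (n ∸ 1) / 2            ∎
    where
    double : ∀ n → ∑[ i < n ] toℕ i * 2 ≡ n * (n ∸ 1)
    double zero = ≡.refl
    double (suc n) = begin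
      ∑[ i < n ] suc (toℕ i) * 2      ≡⟨ ≡.cong (_* 2) (sum-suc {n} toℕ) ⟩
      (n + ∑[ i < n ] toℕ i) * 2      ≡⟨ ℕ.*-distribʳ-+ 2 n _ ⟩
      n * 2 + ∑[ i < n ] toℕ i * 2    ≡⟨ ≡.cong (n * 2 +_) (double n) ⟩
      n * 2 + n * (n ∸ 1)             ≡⟨ ℕ.*-distribˡ-+ n 2 (n ∸ 1) ⟨
      n * (2 + (n ∸ 1))               ≡⟨ n*[1+n] n ⟩
      n + n * n                       ∎
      where
      n*[1+n] : ∀ n → n * (2 + (n ∸ 1)) ≡ n + n * n
      -- At n = 0 truncated subtraction makes 2 + (n ∸ 1) differ from n + 1; the factor n hides the
      -- discrepancy.
      n*[1+n] zero    = ≡.refl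
      n*[1+n] (suc n) = ℕ.*-suc (suc n) (suc n)

  module _ {N : ℕ} where

    diagonal? : Fin N → Fin N → Bool
    diagonal? a b = if does (a Fin.≟ b) then does ((N ∸ toℕ a) ∣? N) else false

    does-isFree? : ∀ (a b : Fin N) →
      does (isFree? (a , b)) ⇒ 1 ≡ (does (toℕ b ℕ.<? toℕ a) ⇒ 1) + (diagonal? a b ⇒ 1)
    does-isFree? a b with toℕ b ℕ.<? toℕ a
    ... | yes b<a rewrite dec-true (toℕ b ℕ.<? toℕ a) b<a | dec-false (a Fin.≟ b) (ℕ.<⇒≢ b<a ∘ ≡.cong toℕ ∘ ≡.sym) = ≡.refl
    ... | no b≮a rewrite dec-false (toℕ b ℕ.<? toℕ a) b≮a with a Fin.≟ b | (N ∸ toℕ a) ∣? N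
    ...   | no _       | yes _ = ≡.refl
    ...   | no _       | no _  = ≡.refl
    ...   | yes _      | no _  = ≡.refl
    ...   | yes ≡.refl | yes _ = ≡.refl

    row-count : ∀ (a : Fin N) →
      ∑[ b < N ] (does (isFree? (a , b)) ⇒ 1) ≡ toℕ a + (does ((N ∸ toℕ a) ∣? N) ⇒ 1)
    row-count a = begin
      ∑[ b < N ] (does (isFree? (a , b)) ⇒ 1)
        ≡⟨ sum-cong-≗ (does-isFree? a) ⟩
      ∑[ b < N ] ((does (toℕ b ℕ.<? toℕ a) ⇒ 1) + (diagonal? a b ⇒ 1))
        ≡⟨ ∑-distrib-+ (λ b → does (toℕ b ℕ.<? toℕ a) ⇒ 1) (λ b → diagonal? a b ⇒ 1) ⟩
      ∑[ b < N ] (does (toℕ b ℕ.<? toℕ a) ⇒ 1) + ∑[ b < N ] (diagonal? a b ⇒ 1)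
        ≡⟨ ≡.cong₂ _+_ (sum-<-indicator (ℕ.<⇒≤ (Fin.toℕ<n a))) (sum-single a off) ⟩
      toℕ a + (diagonal? a a ⇒ 1)
        ≡⟨ ≡.cong (λ p → toℕ a + ((if p then does ((N ∸ toℕ a) ∣? N) else false) ⇒ 1)) (dec-true (a Fin.≟ a) ≡.refl) ⟩
      toℕ a + (does ((N ∸ toℕ a) ∣? N) ⇒ 1) ∎
      where
      off : ∀ b → a ≢ b → diagonal? a b ⇒ 1 ≡ 0
      off b a≢b rewrite dec-false (a Fin.≟ b) a≢b = ≡.refl

  -- Reversing the order of `Fin N` turns N - a into a + 1, the form in which `ν` enumerates
  -- candidates.
  ν-sum : ∀ N → ∑[ a < N ] (does ((N ∸ toℕ a) ∣? N) ⇒ 1) ≡ ν N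
  ν-sum N = begin
    ∑[ a < N ] (does ((N ∸ toℕ a) ∣? N) ⇒ 1)
      ≡⟨ ∑-permute (λ a → does ((N ∸ toℕ a) ∣? N) ⇒ 1) (Permutation.reverse {N}) ⟩
    ∑[ a < N ] (does ((N ∸ toℕ (opposite a)) ∣? N) ⇒ 1)
      ≡⟨ sum-cong-≗ (λ a → ≡.cong (λ k → does (k ∣? N) ⇒ 1) (neg-opposite a)) ⟩
    ∑[ a < N ] (does (suc (toℕ a) ∣? N) ⇒ 1)
      ≡⟨ length-filter-applyUpTo (_∣? N) suc N ⟨
    length (filter (_∣? N) (applyUpTo suc N))
      ≡⟨ ≡.cong (length ∘ filter (_∣? N)) (map-upTo suc N) ⟨
    ν N ∎
    where
    neg-opposite : ∀ (a : Fin N) → N ∸ toℕ (opposite a) ≡ suc (toℕ a)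
    neg-opposite a = ≡.trans (≡.cong (N ∸_) (Fin.opposite-prop a)) (ℕ.m∸[m∸n]≡n (Fin.toℕ<n a))

  length-freePositions : ∀ N → length (freePositions N) ≡ N * (N ∸ 1) / 2 + ν N
  length-freePositions N = begin
    length (freePositions N)
      ≡⟨ length-filter-cartesianProduct isFree? {N} {N} id id ⟩
    ∑[ a < N ] ∑[ b < N ] (does (isFree? (a , b)) ⇒ 1)
      ≡⟨ sum-cong-≗ {N} row-count ⟩
    ∑[ a < N ] (toℕ a + (does ((N ∸ toℕ a) ∣? N) ⇒ 1))
      ≡⟨ ∑-distrib-+ {N} toℕ (λ a → does ((N ∸ toℕ a) ∣? N) ⇒ 1) ⟩
    ∑[ a < N ] toℕ a + ∑[ a < N ] (does ((N ∸ toℕ a) ∣? N) ⇒ 1)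
      ≡⟨ ≡.cong₂ _+_ (sum-toℕ N) (ν-sum N) ⟩
    N * (N ∸ 1) / 2 + ν N ∎

-- Sums over initial segments of ℕ, restricted to multiples

module RangeSums {c ℓ} (M : CommutativeMonoid c ℓ) where

  open CommutativeMonoid M renaming (_∙_ to _+_; ε to 0#; ∙-cong to +-cong; ∙-congˡ to +-congˡ; ∙-congʳ to +-congʳ)
  open Sum M
  open Sums M
  open SetoidReasoning setoid

  sumTo : ℕ → (ℕ → Carrier) → Carrier
  sumTo n F = ∑[ i < n ] F (toℕ i)

  sumTo-cong : ∀ n {F F′ : ℕ → Carrier} → (∀ i → F i ≈ F′ i) → sumTo n F ≈ sumTo n F′
  sumTo-cong n F≈F′ = sum-cong-≋ {n} (λ i → F≈F′ (toℕ i))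

  sumTo-+ : ∀ m n (F : ℕ → Carrier) → sumTo (m ℕ.+ n) F ≈ sumTo m F + sumTo n (λ i → F (m ℕ.+ i))
  sumTo-+ zero    n F = sym (identityˡ _)
  sumTo-+ (suc m) n F = trans (+-congˡ (sumTo-+ m n (F ∘ suc))) (sym (assoc _ _ _))

  sumTo-truncate : ∀ {m n} (F : ℕ → Carrier) → m ℕ.≤ n → (∀ i → m ℕ.≤ i → F i ≈ 0#) → sumTo n F ≈ sumTo m F
  sumTo-truncate {m} {n} F m≤n F≈0 = begin
    sumTo n F                                       ≡⟨ ≡.cong (λ k → sumTo k F) (ℕ.m+[n∸m]≡n m≤n) ⟨
    sumTo (m ℕ.+ (n ∸ m)) F                         ≈⟨ sumTo-+ m (n ∸ m) F ⟩
    sumTo m F + sumTo (n ∸ m) (λ i → F (m ℕ.+ i))   ≈⟨ +-congˡ (sum-zero {n ∸ m} (λ i → F≈0 _ (ℕ.m≤m+n m (toℕ i)))) ⟩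
    sumTo m F + 0#                                  ≈⟨ identityʳ _ ⟩
    sumTo m F                                       ∎

  -- The range splits into k blocks of length d, and only the first index of each block is a
  -- multiple of d.
  sumTo-multiples : ∀ k d .{{_ : NonZero d}} (F : ℕ → Carrier) →
    sumTo (k ℕ.* d) (λ i → does (d ∣? i) ⇒ F i) ≈ sumTo k (λ i → F (i ℕ.* d))
  sumTo-multiples zero    d         F = refl
  sumTo-multiples (suc k) d@(suc e) F = begin
    sumTo (d ℕ.+ k ℕ.* d) F∣
      ≈⟨ sumTo-+ d (k ℕ.* d) F∣ ⟩
    sumTo d F∣ + sumTo (k ℕ.* d) (λ i → F∣ (d ℕ.+ i))
      ≈⟨ +-cong first (sumTo-cong (k ℕ.* d) (λ i → reflexive (≡.cong (_⇒ F (d ℕ.+ i)) (shift i)))) ⟩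
    F 0 + sumTo (k ℕ.* d) (λ i → does (d ∣? i) ⇒ F (d ℕ.+ i))
      ≈⟨ +-congˡ (sumTo-multiples k d (λ i → F (d ℕ.+ i))) ⟩
    F 0 + sumTo k (λ i → F (d ℕ.+ i ℕ.* d)) ∎
    where
    F∣ : ℕ → Carrier
    F∣ i = does (d ∣? i) ⇒ F i
    shift : ∀ i → does (d ∣? (d ℕ.+ i)) ≡ does (d ∣? i)
    shift i = does-⇔ (mk⇔ (λ d∣d+i → ∣m+n∣m⇒∣n d∣d+i ∣-refl) (∣m∣n⇒∣m+n ∣-refl)) (d ∣? (d ℕ.+ i)) (d ∣? i)
    first : sumTo d F∣ ≈ F 0
    first = begin
      (does (d ∣? 0) ⇒ F 0) + sumTo e (F∣ ∘ suc)
        ≈⟨ +-cong (reflexive (≡.cong (_⇒ F 0) (dec-true (d ∣? 0) (d ∣0)))) (sum-zero {e} λ i →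
             reflexive (≡.cong (_⇒ F (suc (toℕ i))) (dec-false (d ∣? suc (toℕ i)) (λ d∣ →
               ℕ.<⇒≱ (Fin.toℕ<n i) (ℕ.s≤s⁻¹ (∣⇒≤ d∣)))))) ⟩
      F 0 + 0#
        ≈⟨ identityʳ (F 0) ⟩
      F 0 ∎

  -- The vanishing term at 0 is inserted so that blocks of length d start at a multiple of d. The
  -- vanishing tail beyond m lets the new index keep the range of the old one.
  sumTo-multiples-suc : ∀ m d .{{_ : NonZero d}} (F : ℕ → Carrier) → F 0 ≈ 0# → (∀ i → m ℕ.< i → F i ≈ 0#) →
    sumTo m (λ i → does (d ∣? suc i) ⇒ F (suc i)) ≈ sumTo m (λ i → F (suc i ℕ.* d))
  sumTo-multiples-suc m d F F0≈0 F≈0 = begin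
    sumTo m (F∣ ∘ suc)                          ≈⟨ identityˡ _ ⟨
    0# + sumTo m (F∣ ∘ suc)                     ≈⟨ +-congʳ (⇒-zero (does (d ∣? 0)) F0≈0) ⟨
    sumTo (suc m) F∣                            ≈⟨ sumTo-truncate F∣ (ℕ.m≤m*n (suc m) d)
      (λ i m<i → ⇒-zero (does (d ∣? i)) (F≈0 i m<i)) ⟨
    sumTo (suc m ℕ.* d) F∣                      ≈⟨ sumTo-multiples (suc m) d F ⟩
    F 0 + sumTo m (λ i → F (suc i ℕ.* d))       ≈⟨ +-congʳ F0≈0 ⟩
    0# + sumTo m (λ i → F (suc i ℕ.* d))        ≈⟨ identityˡ _ ⟩
    sumTo m (λ i → F (suc i ℕ.* d))             ∎
    where
    F∣ : ℕ → Carrier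
    F∣ i = does (d ∣? i) ⇒ F i
    ⇒-zero : ∀ p {x} → x ≈ 0# → p ⇒ x ≈ 0#
    ⇒-zero true  x≈0 = x≈0
    ⇒-zero false _   = refl

-- Roots of unity and the distribution relation

module OverK {c ℓ₁ ℓ₂} (K : HeytingField c ℓ₁ ℓ₂) where

  open OverField K
  open HeytingField K using (_#_; #⇒invertible; tight)
  open CommutativeRing (HeytingCommutativeRing.commutativeRing (HeytingField.heytingCommutativeRing K))
    hiding (zero)
  open SemiringSum semiring
  open Sums +-commutativeMonoid
  open RangeSums +-commutativeMonoid
  open Exp semiring
  open Mult semiring renaming (_×_ to _×ᴷ_)
  open AbelianGroupProperties +-abelianGroup using (∙-cancelˡ; ε⁻¹≈ε)
  open SetoidReasoning setoid

  ⇒-*ˡ : ∀ p x y → p ⇒ (x * y) ≈ x * (p ⇒ y)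
  ⇒-*ˡ true  x y = refl
  ⇒-*ˡ false x y = sym (zeroʳ x)

  ⇒-*ʳ : ∀ p x y → p ⇒ (x * y) ≈ (p ⇒ x) * y
  ⇒-*ʳ true  x y = refl
  ⇒-*ʳ false x y = sym (zeroˡ y)

  1^n≈1 : ∀ n → 1# ^ n ≈ 1#
  1^n≈1 zero    = refl
  1^n≈1 (suc n) = trans (*-identityˡ _) (1^n≈1 n)

  x-0≈x : ∀ x → x - 0# ≈ x
  x-0≈x x = trans (+-congˡ ε⁻¹≈ε) (+-identityʳ x)

  -- By tightness, y ≈ 0 follows once y # 0 is refuted; and y # 0 makes y invertible, hence x ≈ 1.
  *-cancel-≉0 : ∀ {x y} → x * y ≈ y → ¬ (x ≈ 1#) → y ≈ 0#
  *-cancel-≉0 {x} {y} xy≈y x≉1 = proj₁ (tight y 0#) λ y#0 →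
    let (y⁻¹ , _ , yy⁻¹≈1) = #⇒invertible y#0
        y*y⁻¹≈1 = trans (*-congʳ (sym (x-0≈x y))) yy⁻¹≈1
    in x≉1 (begin
      x              ≈⟨ *-identityʳ x ⟨
      x * 1#         ≈⟨ *-congˡ y*y⁻¹≈1 ⟨
      x * (y * y⁻¹)  ≈⟨ *-assoc x y y⁻¹ ⟨
      (x * y) * y⁻¹  ≈⟨ *-congʳ xy≈y ⟩
      y * y⁻¹        ≈⟨ y*y⁻¹≈1 ⟩
      1#             ∎)

  -- Multiplication by x shifts the terms by one place, and the new last term x^n equals the lost
  -- first term 1, so the sum is fixed by x.
  geometric-sum : ∀ {x} n → x ^ n ≈ 1# → ¬ (x ≈ 1#) → sumTo n (x ^_) ≈ 0#
  geometric-sum {x} n x^n≈1 = *-cancel-≉0 (∙-cancelˡ 1# _ _ (begin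
    1# + x * sumTo n (x ^_)             ≈⟨ +-congˡ (*-distribˡ-sum {n} x (λ i → x ^ toℕ i)) ⟩
    sumTo (suc n) (x ^_)                ≡⟨ ≡.cong (λ k → sumTo k (x ^_)) (ℕ.+-comm 1 n) ⟩
    sumTo (n ℕ.+ 1) (x ^_)              ≈⟨ sumTo-+ n 1 (x ^_) ⟩
    sumTo n (x ^_) + (x ^ (n ℕ.+ 0) + 0#) ≈⟨ +-congˡ (trans (+-identityʳ _) (trans (^-congʳ x (ℕ.+-identityʳ n)) x^n≈1)) ⟩
    sumTo n (x ^_) + 1#                 ≈⟨ +-comm _ _ ⟩
    1# + sumTo n (x ^_)                 ∎))

  doubleSeries-cong : ∀ {c c′ : ℕ → ℕ → Carrier} m → (∀ n u → c n u ≈ c′ n u) → doubleSeries c m ≈ doubleSeries c′ m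
  doubleSeries-cong m c≈c′ = sumTo-cong m (λ n → sumTo-cong m (λ u →
    ⇒-cong (does (suc n ℕ.* suc u ℕ.≟ m)) (c≈c′ (suc n) (suc u))))

  ∑-doubleSeries : ∀ {k} (c : Fin k → ℕ → ℕ → Carrier) m →
    ∑[ a < k ] doubleSeries (c a) m ≈ doubleSeries (λ n u → ∑[ a < k ] c a n u) m
  ∑-doubleSeries {k} c m = begin
    ∑[ a < k ] sumTo m (λ n → sumTo m (λ u → p n u ⇒ c a (suc n) (suc u)))
      ≈⟨ ∑-comm {k} {m} _ ⟩
    sumTo m (λ n → ∑[ a < k ] sumTo m (λ u → p n u ⇒ c a (suc n) (suc u)))
      ≈⟨ sumTo-cong m (λ n → ∑-comm {k} {m} (λ a u → p n (toℕ u) ⇒ c a (suc n) (suc (toℕ u)))) ⟩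
    sumTo m (λ n → sumTo m (λ u → ∑[ a < k ] (p n u ⇒ c a (suc n) (suc u))))
      ≈⟨ sumTo-cong m (λ n → sumTo-cong m (λ u → ⇒-sum (p n u) (λ a → c a (suc n) (suc u)))) ⟩
    doubleSeries (λ n u → ∑[ a < k ] c a n u) m ∎
    where
    p : ℕ → ℕ → Bool
    p n u = does (suc n ℕ.* suc u ℕ.≟ m)

  ⇒-doubleSeries : ∀ p (c : ℕ → ℕ → Carrier) m → p ⇒ doubleSeries c m ≈ doubleSeries (λ n u → p ⇒ c n u) m
  ⇒-doubleSeries true  c m = refl
  ⇒-doubleSeries false c m = sym (sum-zero {m} (λ i → sum-zero {m} (λ j →
    zeros (does (suc (toℕ i) ℕ.* suc (toℕ j) ℕ.≟ m)))))
    where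
    zeros : ∀ q → q ⇒ 0# ≈ 0#
    zeros true  = refl
    zeros false = refl

  -- The substitution is u = v d. Large v contribute nothing, and keeping v in the same range as n
  -- allows the two to be exchanged later.
  doubleSeries-multiples : ∀ d .{{_ : NonZero d}} (c : ℕ → ℕ → Carrier) m →
    doubleSeries (λ n u → does (d ∣? u) ⇒ c n u) m ≈
    sumTo m (λ n → sumTo m (λ v → does (suc n ℕ.* (suc v ℕ.* d) ℕ.≟ m) ⇒ c (suc n) (suc v ℕ.* d)))
  -- For m = 0 the inserted index u = 0 would satisfy n u = m, so this case is split off; both sums
  -- are empty.
  doubleSeries-multiples d c zero      = refl
  doubleSeries-multiples d c m@(suc _) = sumTo-cong m (λ n → trans
    (sumTo-cong m (λ u → ⇒-comm (does (suc n ℕ.* suc u ℕ.≟ m)) (does (d ∣? suc u)) (c (suc n) (suc u))))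
    (sumTo-multiples-suc m d (λ u → does (suc n ℕ.* u ℕ.≟ m) ⇒ c (suc n) u)
      (off n 0 (λ eq → contradiction (≡.trans (≡.sym eq) (ℕ.*-zeroʳ (suc n))) λ()))
      (λ u m<u → off n u (λ eq → ℕ.<⇒≱ m<u (≡.subst (u ℕ.≤_) eq (ℕ.m≤n*m u (suc n)))))))
    where
    off : ∀ n u → suc n ℕ.* u ≢ m → does (suc n ℕ.* u ℕ.≟ m) ⇒ c (suc n) u ≈ 0#
    off n u ≢m = reflexive (≡.cong (_⇒ c (suc n) u) (dec-false (suc n ℕ.* u ℕ.≟ m) ≢m))

  module _ {N : ℕ} .{{_ : NonZero N}} {η : Carrier} (η-primitive : IsPrimitiveRoot N η) where

    open IsPrimitiveRoot η-primitive

    η^-multiple : ∀ k → η ^ (k ℕ.* N) ≈ 1#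
    η^-multiple k = begin
      η ^ (k ℕ.* N)  ≡⟨ ≡.cong (η ^_) (ℕ.*-comm k N) ⟩
      η ^ (N ℕ.* k)  ≈⟨ ^-assocʳ η N k ⟨
      (η ^ N) ^ k    ≈⟨ ^-congˡ k η^N≈1 ⟩
      1# ^ k         ≈⟨ 1^n≈1 k ⟩
      1#             ∎

    η^≈1⇒∣ : ∀ k → η ^ k ≈ 1# → N ∣ k
    η^≈1⇒∣ k η^k≈1 with k % N in k%N
    ... | zero  = m%n≡0⇒n∣m k N k%N
    ... | suc r = contradiction (begin
      η ^ suc r                                   ≈⟨ *-identityʳ _ ⟨
      η ^ suc r * 1#                              ≈⟨ *-congˡ (η^-multiple (k ℕ./ N)) ⟨
      η ^ suc r * η ^ (k ℕ./ N ℕ.* N)             ≈⟨ ^-homo-* η (suc r) _ ⟨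
      η ^ (suc r ℕ.+ k ℕ./ N ℕ.* N)               ≡⟨ ≡.cong (λ s → η ^ (s ℕ.+ k ℕ./ N ℕ.* N)) k%N ⟨
      η ^ (k % N ℕ.+ k ℕ./ N ℕ.* N)               ≡⟨ ≡.cong (η ^_) (m≡m%n+[m/n]*n k N) ⟨
      η ^ k                                       ≈⟨ η^k≈1 ⟩
      1#                                          ∎)
      (η^k≉1 (suc r) (ℕ.s≤s ℕ.z≤n) (≡.subst (ℕ._< N) k%N (m%n<n k N)))

    module _ (d M : ℕ) .{{_ : NonZero d}} .{{_ : NonZero M}} (N≡M*d : N ≡ M ℕ.* d) where

      H : Fin N → Bool
      H = multiple? d

      subgroup-sum : ∀ (F : ℕ → Carrier) → ∑[ a < N ] (H a ⇒ F (toℕ a)) ≈ sumTo M (λ i → F (i ℕ.* d))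
      subgroup-sum F = trans
        (reflexive (≡.cong (λ k → sumTo k (λ i → does (d ∣? i) ⇒ F i)) N≡M*d))
        (sumTo-multiples M d F)

      subgroup-const : ∀ x → ∑[ a < N ] (H a ⇒ x) ≈ (M ×ᴷ 1#) * x
      subgroup-const x = begin
        ∑[ a < N ] (H a ⇒ x)  ≈⟨ subgroup-sum (λ _ → x) ⟩
        sumTo M (λ _ → x)     ≈⟨ sum-replicate M ⟩
        M ×ᴷ x                ≈⟨ ×-congʳ M (*-identityˡ x) ⟨
        M ×ᴷ (1# * x)         ≈⟨ ×-assoc-* M 1# x ⟨
        (M ×ᴷ 1#) * x         ∎

      -- Orthogonality of characters: a ↦ η^(a u) on the subgroup dℤ/N of order M is trivial exactly
      -- when M divides u. Otherwise its values are the powers of some ζ ≠ 1 with ζ^M = 1.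
      character-sum : ∀ u → ∑[ a < N ] (H a ⇒ η ^ (toℕ a ℕ.* u)) ≈ does (M ∣? u) ⇒ (M ×ᴷ 1#)
      character-sum u = trans (subgroup-sum (λ i → η ^ (i ℕ.* u))) (by-cases (M ∣? u))
        where
        ζ : Carrier
        ζ = η ^ (d ℕ.* u)
        ζ^ : ∀ i → η ^ (i ℕ.* d ℕ.* u) ≈ ζ ^ i
        ζ^ i = begin
          η ^ (i ℕ.* d ℕ.* u)    ≡⟨ ≡.cong (η ^_) (≡.trans (ℕ.*-assoc i d u) (ℕ.*-comm i (d ℕ.* u))) ⟩
          η ^ (d ℕ.* u ℕ.* i)    ≈⟨ ^-assocʳ η (d ℕ.* u) i ⟨
          ζ ^ i                  ∎
        d*u≡q*N : ∀ q → u ≡ q ℕ.* M → d ℕ.* u ≡ q ℕ.* N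
        d*u≡q*N q u≡ = ≡.trans (≡.cong (d ℕ.*_) u≡) (≡.trans (ℕ.*-comm d (q ℕ.* M))
          (≡.trans (ℕ.*-assoc q M d) (≡.cong (q ℕ.*_) (≡.sym N≡M*d))))
        ζ^M≈1 : ζ ^ M ≈ 1#
        ζ^M≈1 = begin
          ζ ^ M                  ≈⟨ ζ^ M ⟨
          η ^ (M ℕ.* d ℕ.* u)    ≡⟨ ≡.cong (λ k → η ^ (k ℕ.* u)) N≡M*d ⟨
          η ^ (N ℕ.* u)          ≡⟨ ≡.cong (η ^_) (ℕ.*-comm N u) ⟩
          η ^ (u ℕ.* N)          ≈⟨ η^-multiple u ⟩
          1#                     ∎
        by-cases : (M∣?u : Dec (M ∣ u)) → sumTo M (λ i → η ^ (i ℕ.* d ℕ.* u)) ≈ does M∣?u ⇒ (M ×ᴷ 1#)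
        by-cases (yes (divides q u≡)) = begin
          sumTo M (λ i → η ^ (i ℕ.* d ℕ.* u))  ≈⟨ sumTo-cong M (λ i → trans (ζ^ i) (trans (^-congˡ i ζ≈1) (1^n≈1 i))) ⟩
          sumTo M (λ _ → 1#)                   ≈⟨ sum-replicate M ⟩
          M ×ᴷ 1#                              ∎
          where
          ζ≈1 : ζ ≈ 1#
          ζ≈1 = trans (^-congʳ η (d*u≡q*N q u≡)) (η^-multiple q)
        by-cases (no M∤u) = trans (sumTo-cong M ζ^) (geometric-sum M ζ^M≈1 λ ζ≈1 →
          M∤u (*-cancelˡ-∣ d (≡.subst (_∣ d ℕ.* u) (≡.trans N≡M*d (ℕ.*-comm M d)) (η^≈1⇒∣ (d ℕ.* u) ζ≈1))))

      module _ (w : Carrier) (m : ℕ) where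

        -- Orthogonality leaves the terms u = v M, each with weight M. The weight `k` is n for f and
        -- u for g; `w` will be 1/N².
        subgroup-series : ∀ (k : ℕ → ℕ → Carrier) →
          ∑[ a < N ] (H a ⇒ (w * doubleSeries (λ n u → η ^ (toℕ a ℕ.* u) * k n u) m)) ≈
          w * sumTo m (λ n → sumTo m (λ v → does (suc n ℕ.* (suc v ℕ.* M) ℕ.≟ m) ⇒ ((M ×ᴷ 1#) * k (suc n) (suc v ℕ.* M))))
        subgroup-series k = begin
          ∑[ a < N ] (H a ⇒ (w * doubleSeries (e a) m))
            ≈⟨ sum-cong-≋ (λ a → ⇒-*ˡ (H a) w _) ⟩
          ∑[ a < N ] (w * (H a ⇒ doubleSeries (e a) m))
            ≈⟨ *-distribˡ-sum w (λ a → H a ⇒ doubleSeries (e a) m) ⟨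
          w * ∑[ a < N ] (H a ⇒ doubleSeries (e a) m)
            ≈⟨ *-congˡ (sum-cong-≋ (λ a → ⇒-doubleSeries (H a) (e a) m)) ⟩
          w * ∑[ a < N ] doubleSeries (λ n u → H a ⇒ e a n u) m
            ≈⟨ *-congˡ (∑-doubleSeries (λ a n u → H a ⇒ e a n u) m) ⟩
          w * doubleSeries (λ n u → ∑[ a < N ] (H a ⇒ e a n u)) m
            ≈⟨ *-congˡ (doubleSeries-cong m inner) ⟩
          w * doubleSeries (λ n u → does (M ∣? u) ⇒ ((M ×ᴷ 1#) * k n u)) m
            ≈⟨ *-congˡ (doubleSeries-multiples M (λ n u → (M ×ᴷ 1#) * k n u) m) ⟩
          _ ∎
          where
          e : Fin N → ℕ → ℕ → Carrier
          e a n u = η ^ (toℕ a ℕ.* u) * k n u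
          inner : ∀ n u → ∑[ a < N ] (H a ⇒ e a n u) ≈ does (M ∣? u) ⇒ ((M ×ᴷ 1#) * k n u)
          inner n u = begin
            ∑[ a < N ] (H a ⇒ e a n u)                           ≈⟨ sum-cong-≋ (λ a → ⇒-*ʳ (H a) _ (k n u)) ⟩
            ∑[ a < N ] ((H a ⇒ η ^ (toℕ a ℕ.* u)) * k n u)       ≈⟨ *-distribʳ-sum (k n u) (λ a → H a ⇒ η ^ (toℕ a ℕ.* u)) ⟨
            ∑[ a < N ] (H a ⇒ η ^ (toℕ a ℕ.* u)) * k n u         ≈⟨ *-congʳ (character-sum u) ⟩
            (does (M ∣? u) ⇒ (M ×ᴷ 1#)) * k n u                  ≈⟨ ⇒-*ʳ (does (M ∣? u)) _ _ ⟨
            does (M ∣? u) ⇒ ((M ×ᴷ 1#) * k n u)                  ∎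

        -- Both sides are sums over n v M = m. The free sum over b contributes a second factor M, so
        -- f has the weight M · (n M), while g has M · (v M); exchanging n and v identifies them.
        distribution-coefficient :
          ∑[ a < N ] ∑[ b < N ] (H a ⇒ H b ⇒ (w * doubleSeries (λ n u → η ^ (toℕ a ℕ.* u) * (n ×ᴷ 1#)) m)) ≈
          ∑[ a < N ] (H a ⇒ (w * doubleSeries (λ n u → η ^ (toℕ a ℕ.* u) * (u ×ᴷ 1#)) m))
        distribution-coefficient = begin
          ∑[ a < N ] ∑[ b < N ] (H a ⇒ H b ⇒ x a)
            ≈⟨ sum-cong-≋ (λ a → trans (⇒-sum (H a) (λ b → H b ⇒ x a))
                 (trans (⇒-cong (H a) (subgroup-const (x a))) (⇒-*ˡ (H a) M# (x a)))) ⟩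
          ∑[ a < N ] (M# * (H a ⇒ x a))
            ≈⟨ *-distribˡ-sum M# (λ a → H a ⇒ x a) ⟨
          M# * ∑[ a < N ] (H a ⇒ x a)
            ≈⟨ *-congˡ (subgroup-series (λ n _ → n ×ᴷ 1#)) ⟩
          M# * (w * sumTo m (λ n → sumTo m (λ v → p n v ⇒ (M# * (suc n ×ᴷ 1#)))))
            ≈⟨ x∙yz≈y∙xz M# w _ ⟩
          w * (M# * sumTo m (λ n → sumTo m (λ v → p n v ⇒ (M# * (suc n ×ᴷ 1#)))))
            ≈⟨ *-congˡ (trans (*-distribˡ-sum {m} M# _) (sumTo-cong m (λ n → trans (*-distribˡ-sum {m} M# _)
                 (sumTo-cong m (λ v → trans (sym (⇒-*ˡ (p n v) M# _)) (⇒-cong (p n v) (absorb (suc n)))))))) ⟩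
          w * sumTo m (λ n → sumTo m (λ v → p n v ⇒ (M# * ((suc n ℕ.* M) ×ᴷ 1#))))
            ≈⟨ *-congˡ (∑-comm {m} {m} _) ⟩
          w * sumTo m (λ v → sumTo m (λ n → p n v ⇒ (M# * ((suc n ℕ.* M) ×ᴷ 1#))))
            ≈⟨ *-congˡ (sumTo-cong m (λ v → sumTo-cong m (λ n → reflexive
                 (≡.cong (_⇒ (M# * ((suc n ℕ.* M) ×ᴷ 1#))) (p-sym n v))))) ⟩
          w * sumTo m (λ v → sumTo m (λ n → p v n ⇒ (M# * ((suc n ℕ.* M) ×ᴷ 1#))))
            ≈⟨ subgroup-series (λ _ u → u ×ᴷ 1#) ⟨
          _ ∎
          where
          open CommutativeSemigroupProperties *-commutativeSemigroup using (x∙yz≈y∙xz)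
          M# : Carrier
          M# = M ×ᴷ 1#
          x : Fin N → Carrier
          x a = w * doubleSeries (λ n u → η ^ (toℕ a ℕ.* u) * (n ×ᴷ 1#)) m
          p : ℕ → ℕ → Bool
          p n v = does (suc n ℕ.* (suc v ℕ.* M) ℕ.≟ m)
          p-sym : ∀ n v → p n v ≡ p v n
          p-sym n v = ≡.cong (λ k → does (k ℕ.≟ m)) (≡.trans (≡.sym (ℕ.*-assoc (suc n) (suc v) M))
            (≡.trans (≡.cong (ℕ._* M) (ℕ.*-comm (suc n) (suc v))) (ℕ.*-assoc (suc v) (suc n) M)))
          absorb : ∀ n → M# * (M# * (n ×ᴷ 1#)) ≈ M# * ((n ℕ.* M) ×ᴷ 1#)
          absorb n = *-congˡ (trans (*-comm _ _) (sym (×1-homo-* n M)))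

-- Back to power series and the system with λ

module Linear {c ℓ₁ ℓ₂} (K : HeytingField c ℓ₁ ℓ₂) (char0 : OverField.CharacteristicZero K)
  (N : ℕ) .{{_ : NonZero N}} (η : HeytingField.Carrier K)
  (η-primitive : OverField.IsPrimitiveRoot K N η) where

  open OverField K
  open LinearSystem char0 N η
  open Unknowns
  open HeytingField K using (_#_; #⇒invertible; tight)
  open CommutativeRing (HeytingCommutativeRing.commutativeRing (HeytingField.heytingCommutativeRing K))
    hiding (zero)
  open AbelianGroupProperties +-abelianGroup
    using (∙-cancelˡ; ∙-cancelʳ; //-rightDividesˡ; x≈z//y; x∙y⁻¹≈ε⇒x≈y; x≈y⇒x∙y⁻¹≈ε)
  open CommutativeSemigroupProperties +-commutativeSemigroup using (interchange)
  open RingProperties ring using (-1*x≈-x)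
  open Mult semiring renaming (_×_ to _×ᴷ_)
  open SemiringSum semiring
  open Sums +-commutativeMonoid
  open OverK K using (distribution-coefficient; x-0≈x)
  open SetoidReasoning setoid

  seriesGroup : AbelianGroup c ℓ₁
  seriesGroup = Pointwise.abelianGroup ℕ +-abelianGroup

  open Solver seriesGroup f₂ g̃₂
  private module Series = Sum (AbelianGroup.commutativeMonoid seriesGroup)
  private module SeriesSums = Sums (AbelianGroup.commutativeMonoid seriesGroup)

  sum-at : ∀ {n} (t : Fin n → PowerSeries) m → Series.sum t m ≡ ∑[ i < n ] t i m
  sum-at {zero}  t m = ≡.refl
  sum-at {suc n} t m = ≡.cong (t zero m +_) (sum-at (t ∘ suc) m)

  ⇒-at : ∀ p (h : PowerSeries) m → (p SeriesSums.⇒ h) m ≡ p ⇒ h m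
  ⇒-at true  h m = ≡.refl
  ⇒-at false h m = ≡.refl

  distributionRelation : DistributionRelation
  distributionRelation d (divides M N≡M*d) m = begin
    ∑² H (λ a _ → f₂ a) m
      ≡⟨ sum-at (λ a → Series.sum (λ b → H a SeriesSums.⇒ H b SeriesSums.⇒ f₂ a)) m ⟩
    ∑[ a < N ] Series.sum (λ b → H a SeriesSums.⇒ H b SeriesSums.⇒ f₂ a) m
      ≡⟨ sum-cong-≗ (λ a → ≡.trans (sum-at (λ b → H a SeriesSums.⇒ H b SeriesSums.⇒ f₂ a) m)
           (sum-cong-≗ (λ b → ≡.trans (⇒-at (H a) _ m) (≡.cong (H a ⇒_) (⇒-at (H b) _ m))))) ⟩
    ∑[ a < N ] ∑[ b < N ] (H a ⇒ H b ⇒ f₂ a m)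
      ≈⟨ distribution-coefficient η-primitive d M {{d≢0}} {{M≢0}} N≡M*d (1/N * 1/N) m ⟩
    ∑[ a < N ] (H a ⇒ g̃₂ a m)
      ≡⟨ sum-cong-≗ (λ a → ⇒-at (H a) (g̃₂ a) m) ⟨
    ∑[ a < N ] ((H a SeriesSums.⇒ g̃₂ a) m)
      ≡⟨ sum-at (λ a → H a SeriesSums.⇒ g̃₂ a) m ⟨
    Series.sum (λ a → H a SeriesSums.⇒ g̃₂ a) m ∎
    where
    H : Fin N → Bool
    H = multiple? d
    M*d≢0 : NonZero (M ℕ.* d)
    M*d≢0 = ℕ.≢-nonZero (λ M*d≡0 → ℕ.≢-nonZero⁻¹ N (≡.trans N≡M*d M*d≡0))
    d≢0 : NonZero d
    d≢0 = ℕ.m*n≢0⇒n≢0 M {{M*d≢0}}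
    M≢0 : NonZero M
    M≢0 = ℕ.m*n≢0⇒m≢0 M {{M*d≢0}}

  ½ : Carrier
  ½ = proj₁ (#⇒invertible (char0 2))

  half+half : ∀ x → ½ * x + ½ * x ≈ x
  half+half x = begin
    ½ * x + ½ * x                  ≈⟨ distribʳ x ½ ½ ⟨
    -- The zeros appear because 2 ×ᴷ 1# unfolds to 1# + (1# + 0#).
    (½ + ½) * x                     ≈⟨ *-congʳ (+-cong (*-identityʳ ½) (trans (+-identityʳ _) (*-identityʳ ½))) ⟨
    (½ * 1# + (½ * 1# + 0#)) * x ≈⟨ *-congʳ (+-congˡ (+-congˡ (zeroʳ ½))) ⟨
    (½ * 1# + (½ * 1# + ½ * 0#)) * x ≈⟨ *-congʳ (trans (distribˡ ½ _ _) (+-congˡ (distribˡ ½ _ _))) ⟨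
    (½ * (2 ×ᴷ 1#)) * x             ≈⟨ *-congʳ (*-congˡ (x-0≈x _)) ⟨
    (½ * ((2 ×ᴷ 1#) - 0#)) * x      ≈⟨ *-congʳ (proj₁ (proj₂ (#⇒invertible (char0 2)))) ⟩
    1# * x                           ≈⟨ *-identityˡ x ⟩
    x                                 ∎

  torsion-free : ∀ x y → x + x ≈ y + y → x ≈ y
  torsion-free x y x+x≈y+y = begin
    x                 ≈⟨ half+half x ⟨
    ½ * x + ½ * x  ≈⟨ distribˡ ½ x x ⟨
    ½ * (x + x)     ≈⟨ *-congˡ x+x≈y+y ⟩
    ½ * (y + y)     ≈⟨ distribˡ ½ y y ⟩
    ½ * y + ½ * y  ≈⟨ half+half y ⟩
    y                 ∎

  open Uniqueness (λ x y x+x≈y+y m → torsion-free (x m) (y m) (x+x≈y+y m)) using (unique)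
  open Existence distributionRelation using (solution-solves)

  2#*x≈x+x : ∀ x → 2# * x ≈ x + x
  2#*x≈x+x x = trans (distribʳ x 1# 1#) (+-cong (*-identityˡ x) (*-identityˡ x))

  -- The third family of equations solved for λ. Given this choice, the first two families amount to
  -- `Solves γ`.
  lamOf : (Fin N → Fin N → PowerSeries) → Fin N → Fin N → PowerSeries
  lamOf γ a b = ½ ·ₛ (γ (a ⊕ b) a +ₛ γ (a ⊕ b) b -ₛ (f₂ a +ₛ f₂ b))

  unknownsOf : (Fin N → Fin N → PowerSeries) → Unknowns
  unknownsOf γ = record { γ = γ ; lam = lamOf γ }

  module _ {γ : Fin N → Fin N → PowerSeries} (γ-solves : Solves γ) where

    private
      S F : Fin N → Fin N → PowerSeries
      S a b = γ (a ⊕ b) a +ₛ γ (a ⊕ b) b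
      F a b = f₂ a +ₛ f₂ b

    2lamOf : ∀ a b m → lamOf γ a b m + lamOf γ a b m ≈ S a b m - F a b m
    2lamOf a b m = half+half _

    unknownsOf-solution : IsSolution (unknownsOf γ)
    unknownsOf-solution = record
      { lam-sym = λ a b m → *-congˡ (+-cong
          (trans (reflexive (≡.cong (λ e → γ e a m + γ e b m) (⊕-comm a b))) (+-comm _ _))
          (-‿cong (+-comm _ _)))
      -- The equation is checked after doubling and adding f(a) + f(a), where it becomes E(a , a).
      ; eq-diag = λ a m → sym (x≈z//y _ _ _ (torsion-free _ _ (∙-cancelʳ (F a a m) _ _ (begin
          ((g̃₂ a m + l a m) + (g̃₂ a m + l a m)) + F a a m
            ≈⟨ +-congʳ (interchange _ _ _ _) ⟩
          ((g̃₂ a m + g̃₂ a m) + (l a m + l a m)) + F a a m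
            ≈⟨ +-congʳ (+-congˡ (2lamOf a a m)) ⟩
          ((g̃₂ a m + g̃₂ a m) + (S a a m - F a a m)) + F a a m
            ≈⟨ +-assoc _ _ _ ⟩
          (g̃₂ a m + g̃₂ a m) + ((S a a m - F a a m) + F a a m)
            ≈⟨ +-congˡ (//-rightDividesˡ _ _) ⟩
          (g̃₂ a m + g̃₂ a m) + S a a m
            ≈⟨ +-comm _ _ ⟩
          S a a m + (g̃₂ a m + g̃₂ a m)
            ≈⟨ +-congˡ (diagonalTerm-≡ a m) ⟨
          lhs γ a a m
            ≈⟨ γ-solves a a m ⟩
          (γ a a m + γ a a m) + F a a m ∎))))
      ; eq-off = λ a b a≢b m → x≈y⇒x∙y⁻¹≈ε (begin
          γ a b m + γ b a m
            ≈⟨ x≈z//y _ _ _ (trans (sym (γ-solves a b m)) (lhs-≢ γ a≢b m)) ⟩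
          S a b m - F a b m
            ≈⟨ 2lamOf a b m ⟨
          lamOf γ a b m + lamOf γ a b m
            ≈⟨ 2#*x≈x+x _ ⟨
          2# * lamOf γ a b m ∎)
      ; eq-sum = λ a b m → sym (x≈z//y _ _ _ (begin
          F a b m + 2# * lamOf γ a b m
            ≈⟨ +-congˡ (trans (2#*x≈x+x _) (2lamOf a b m)) ⟩
          F a b m + (S a b m - F a b m)
            ≈⟨ trans (+-comm _ _) (//-rightDividesˡ _ _) ⟩
          S a b m ∎))
      }
      where
      l : Fin N → PowerSeries
      l a = lamOf γ a a

  module _ {x : Unknowns} (x-solution : IsSolution x) where

    open IsSolution x-solution

    private
      S F : Fin N → Fin N → PowerSeries
      S a b = γ x (a ⊕ b) a +ₛ γ x (a ⊕ b) b
      F a b = f₂ a +ₛ f₂ b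

    move : ∀ {u v w} → u - v ≈ w → u ≈ w + v
    move {u} {v} u-v≈w = trans (sym (//-rightDividesˡ v u)) (+-congʳ u-v≈w)

    S≈F+2lam : ∀ a b m → S a b m ≈ F a b m + (lam x a b m + lam x a b m)
    S≈F+2lam a b m = trans (move (eq-sum a b m)) (+-congˡ (2#*x≈x+x _))

    lam-determined : ∀ a b → lam x a b ≈ₛ lamOf (γ x) a b
    lam-determined a b m = torsion-free _ _ (trans
      (x≈z//y _ _ _ (trans (+-comm _ _) (sym (S≈F+2lam a b m))))
      (sym (half+half _)))

    γ-solves : Solves (γ x)
    γ-solves = solves-by-cases
      (λ a b a≢b m → begin
        S a b m                                        ≈⟨ S≈F+2lam a b m ⟩
        F a b m + (lam x a b m + lam x a b m)        ≈⟨ +-comm _ _ ⟩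
        (lam x a b m + lam x a b m) + F a b m        ≈⟨ +-congʳ (2#*x≈x+x _) ⟨
        2# * lam x a b m + F a b m                   ≈⟨ +-congʳ (x∙y⁻¹≈ε⇒x≈y _ _ (eq-off a b a≢b m)) ⟨
        (γ x a b m + γ x b a m) + F a b m            ∎)
      (λ a m → begin
        S a a m + (g̃₂ a m + g̃₂ a m)
          ≈⟨ +-congʳ (S≈F+2lam a a m) ⟩
        (F a a m + (lam x a a m + lam x a a m)) + (g̃₂ a m + g̃₂ a m)
          ≈⟨ +-assoc _ _ _ ⟩
        F a a m + ((lam x a a m + lam x a a m) + (g̃₂ a m + g̃₂ a m))
          ≈⟨ +-comm _ _ ⟩
        ((lam x a a m + lam x a a m) + (g̃₂ a m + g̃₂ a m)) + F a a m
          ≈⟨ +-congʳ (trans (+-comm _ _) (interchange _ _ _ _)) ⟩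
        ((g̃₂ a m + lam x a a m) + (g̃₂ a m + lam x a a m)) + F a a m
          ≈⟨ +-congʳ (+-cong (move (eq-diag a m)) (move (eq-diag a m))) ⟨
        (γ x a a m + γ x a a m) + F a a m ∎)

  isFree⇒ : ∀ {P : Fin N → Fin N → Set ℓ₁} → (∀ a b → toℕ b ℕ.< toℕ a → P a b) →
            (∀ a → IsDivisor a → P a a) → ∀ a b → IsFree (a , b) → P a b
  isFree⇒ low divisor a b (below b<a) = low a b b<a
  isFree⇒ {P} low divisor a b (diagonal d _ d≤N d∣N a≡ b≡) =
    ≡.subst (P a) (Fin.toℕ-injective (≡.trans a≡ (≡.sym b≡))) (divisor a
      (≡.subst (_∣ N) (≡.sym (≡.trans (≡.cong (N ∸_) a≡) (ℕ.m∸[m∸n]≡n d≤N))) d∣N))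

  isDivisor⇒isFree : ∀ {a} → IsDivisor a → IsFree (a , a)
  isDivisor⇒isFree {a} ∣N = diagonal (N ∸ toℕ a) (ℕ.m<n⇒0<n∸m (Fin.toℕ<n a)) (ℕ.m∸n≤m N (toℕ a)) ∣N a≡ a≡
    where
    a≡ : toℕ a ≡ N ∸ (N ∸ toℕ a)
    a≡ = ≡.sym (ℕ.m∸[m∸n]≡n (ℕ.<⇒≤ (Fin.toℕ<n a)))

  freeVariables : AreFreeVariables IsFree
  freeVariables φ = unknownsOf (solution φ) , unknownsOf-solution (solution-solves φ) ,
    isFree⇒ (proj₁ (solution-agrees φ)) (proj₂ (solution-agrees φ)) ,
    λ y y-solution y-agrees →
      let γ≈ = unique (γ-solves y-solution) (solution-solves φ)
            ( (λ a b b<a m → trans (y-agrees a b (below b<a) m) (sym (proj₁ (solution-agrees φ) a b b<a m)))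
            , (λ a ∣N m → trans (y-agrees a a (isDivisor⇒isFree ∣N) m) (sym (proj₂ (solution-agrees φ) a ∣N m))))
      in γ≈ , λ a b m → trans (lam-determined y-solution a b m)
           (*-congˡ (+-congʳ (+-cong (γ≈ (a ⊕ b) a m) (γ≈ (a ⊕ b) b m))))

  -- The span of the series and infinitely many solutions inside it

  combination : (Fin N → Carrier) → (Fin N → Carrier) → PowerSeries
  combination μ κ m = ∑[ a < N ] (μ a * f₂ a m + κ a * g̃₂ a m)

  inSpan-0 : InSpan 0ₛ
  inSpan-0 = (λ _ → 0#) , (λ _ → 0#) , λ m →
    sym (sum-zero {N} (λ a → trans (+-cong (zeroˡ _) (zeroˡ _)) (+-identityˡ 0#)))

  inSpan-+ : ∀ {h k} → InSpan h → InSpan k → InSpan (h +ₛ k)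
  inSpan-+ {h} {k} (μ , κ , h≈) (μ′ , κ′ , k≈) = (λ a → μ a + μ′ a) , (λ a → κ a + κ′ a) , λ m → begin
    h m + k m
      ≈⟨ +-cong (h≈ m) (k≈ m) ⟩
    combination μ κ m + combination μ′ κ′ m
      ≈⟨ ∑-distrib-+ (λ a → μ a * f₂ a m + κ a * g̃₂ a m) (λ a → μ′ a * f₂ a m + κ′ a * g̃₂ a m) ⟨
    ∑[ a < N ] ((μ a * f₂ a m + κ a * g̃₂ a m) + (μ′ a * f₂ a m + κ′ a * g̃₂ a m))
      ≈⟨ sum-cong-≋ {N} (λ a → trans (interchange _ _ _ _)
           (+-cong (sym (distribʳ (f₂ a m) _ _)) (sym (distribʳ (g̃₂ a m) _ _)))) ⟩
    combination (λ a → μ a + μ′ a) (λ a → κ a + κ′ a) m ∎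

  inSpan-· : ∀ x {h} → InSpan h → InSpan (x ·ₛ h)
  inSpan-· x {h} (μ , κ , h≈) = (λ a → x * μ a) , (λ a → x * κ a) , λ m → begin
    x * h m
      ≈⟨ *-congˡ (h≈ m) ⟩
    x * combination μ κ m
      ≈⟨ *-distribˡ-sum x (λ a → μ a * f₂ a m + κ a * g̃₂ a m) ⟩
    ∑[ a < N ] (x * (μ a * f₂ a m + κ a * g̃₂ a m))
      ≈⟨ sum-cong-≋ {N} (λ a → trans (distribˡ x _ _)
           (+-cong (sym (*-assoc x (μ a) (f₂ a m))) (sym (*-assoc x (κ a) (g̃₂ a m))))) ⟩
    combination (λ a → x * μ a) (λ a → x * κ a) m ∎

  inSpan-neg : ∀ {h : PowerSeries} → InSpan h → InSpan (λ m → - h m)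
  inSpan-neg {h} h∈ = let (μ , κ , h≈) = inSpan-· (- 1#) {h} h∈ in μ , κ , λ m → trans (sym (-1*x≈-x (h m))) (h≈ m)

  unit : Fin N → Fin N → Carrier
  unit a b = does (a Fin.≟ b) ⇒ 1#

  sum-unit : ∀ a (h : Fin N → Carrier) → ∑[ b < N ] (unit a b * h b) ≈ h a
  sum-unit a h = trans
    (sum-single a (λ b a≢b → trans (*-congʳ (reflexive (≡.cong (_⇒ 1#) (dec-false (a Fin.≟ b) a≢b)))) (zeroˡ (h b))))
    (trans (*-congʳ (reflexive (≡.cong (_⇒ 1#) (dec-true (a Fin.≟ a) ≡.refl)))) (*-identityˡ (h a)))

  inSpan-f₂ : ∀ a → InSpan (f₂ a)
  inSpan-f₂ a = unit a , (λ _ → 0#) , λ m → sym (trans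
    (sum-cong-≋ {N} (λ b → trans (+-congˡ (zeroˡ (g̃₂ b m))) (+-identityʳ _)))
    (sum-unit a (λ b → f₂ b m)))

  inSpan-g̃₂ : ∀ a → InSpan (g̃₂ a)
  inSpan-g̃₂ a = (λ _ → 0#) , unit a , λ m → sym (trans
    (sum-cong-≋ {N} (λ b → trans (+-congʳ (zeroˡ (f₂ b m))) (+-identityˡ _)))
    (sum-unit a (λ b → g̃₂ b m)))

  open Closure InSpan inSpan-0 inSpan-+ inSpan-neg inSpan-f₂ inSpan-g̃₂ using (solution-closed)

  unknownsOf-expressible : ∀ {γ} → (∀ a b → InSpan (γ a b)) → IsExpressible (unknownsOf γ)
  unknownsOf-expressible γ∈ = γ∈ , λ a b → inSpan-· ½
    (inSpan-+ (inSpan-+ (γ∈ (a ⊕ b) a) (γ∈ (a ⊕ b) b)) (inSpan-neg (inSpan-+ (inSpan-f₂ a) (inSpan-f₂ b))))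

  ×1-injective : ∀ k l → k ×ᴷ 1# ≈ l ×ᴷ 1# → k ≡ l
  ×1-injective zero    zero    _  = ≡.refl
  ×1-injective zero    (suc l) eq = contradiction (char0 (suc l)) (proj₂ (tight _ _) (sym eq))
  ×1-injective (suc k) zero    eq = contradiction (char0 (suc k)) (proj₂ (tight _ _) eq)
  ×1-injective (suc k) (suc l) eq = ≡.cong suc (×1-injective k l (∙-cancelˡ 1# _ _ eq))

  origin : Fin N
  origin = 0 mod N

  toℕ-origin : toℕ origin ≡ 0
  toℕ-origin = ≡.trans (Fin.toℕ-fromℕ< (m%n<n 0 N)) (m<n⇒m%n≡m (ℕ.>-nonZero⁻¹ N))

  f₂-origin-1 : f₂ origin 1 ≈ 1/N * 1/N
  f₂-origin-1 = begin
    (1/N * 1/N) * (((η ^ (toℕ origin ℕ.* 1)) * (1# + 0#) + 0#) + 0#)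
      ≈⟨ *-congˡ (trans (+-identityʳ _) (+-identityʳ _)) ⟩
    (1/N * 1/N) * ((η ^ (toℕ origin ℕ.* 1)) * (1# + 0#))
      ≈⟨ *-congˡ (*-cong (reflexive (≡.cong (λ k → η ^ (k ℕ.* 1)) toℕ-origin)) (+-identityʳ 1#)) ⟩
    (1/N * 1/N) * (1# * 1#)
      ≈⟨ trans (*-congˡ (*-identityˡ 1#)) (*-identityʳ _) ⟩
    1/N * 1/N ∎
    where open Exp semiring

  *-1/N-cancel : ∀ x y → x * 1/N ≈ y * 1/N → x ≈ y
  *-1/N-cancel x y eq = begin
    x                        ≈⟨ undo x ⟨
    (x * 1/N) * N#         ≈⟨ *-congʳ eq ⟩
    (y * 1/N) * N#         ≈⟨ undo y ⟩
    y                        ∎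
    where
    N# : Carrier
    N# = (N ×ᴷ 1#) - 0#
    undo : ∀ x → (x * 1/N) * N# ≈ x
    undo x = trans (*-assoc x 1/N N#) (trans (*-congˡ (proj₁ (proj₂ (#⇒invertible (char0 N))))) (*-identityʳ x))

  -- The position (0 , 0) is free for every N, as the case d = N. The coefficient of q in the series
  -- f₂ at 0 is 1/N², which is invertible, so in characteristic 0 the multiples by different k give
  -- different solutions, all within the span.
  prescribed : ℕ → Fin N → Fin N → PowerSeries
  prescribed k _ _ = (k ×ᴷ 1#) ·ₛ f₂ origin

  family : ℕ → Unknowns
  family k = unknownsOf (solution (prescribed k))

  family-injective : Injective _≡_ _≈ᵤ_ family
  family-injective {k} {l} (γ≈ , _) = ×1-injective k l (*-1/N-cancel _ _ (*-1/N-cancel _ _ (begin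
    ((k ×ᴷ 1#) * 1/N) * 1/N              ≈⟨ value k ⟨
    solution (prescribed k) origin origin 1  ≈⟨ γ≈ origin origin 1 ⟩
    solution (prescribed l) origin origin 1  ≈⟨ value l ⟩
    ((l ×ᴷ 1#) * 1/N) * 1/N              ∎)))
    where
    origin-divisor : IsDivisor origin
    origin-divisor = ≡.subst (λ k → N ∸ k ∣ N) (≡.sym toℕ-origin) ∣-refl
    value : ∀ k → solution (prescribed k) origin origin 1 ≈ ((k ×ᴷ 1#) * 1/N) * 1/N
    value k = trans (proj₂ (solution-agrees (prescribed k)) origin origin-divisor 1)
      (trans (*-congˡ f₂-origin-1) (sym (*-assoc _ _ _)))

  expressibleSolutions : Σ[ s ∈ (ℕ → Unknowns) ]
    ((∀ k → IsSolution (s k)) × (∀ k → IsExpressible (s k)) × Injective _≡_ _≈ᵤ_ s)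
  expressibleSolutions = family ,
    (λ k → unknownsOf-solution (solution-solves (prescribed k))) ,
    (λ k → unknownsOf-expressible (solution-closed (λ _ _ → inSpan-· (k ×ᴷ 1#) (inSpan-f₂ origin)))) ,
    family-injective

open import Data.Nat.Base using (_+_; _*_; _/_)

theorem8p1 : ∀ {c ℓ₁ ℓ₂ : Level} (K : HeytingField c ℓ₁ ℓ₂)
    (char0 : OverField.CharacteristicZero K)
    (N : ℕ) .{{_ : NonZero N}}
    (η : HeytingField.Carrier K) → OverField.IsPrimitiveRoot K N η →
    let open OverField.LinearSystem K char0 N η in
    (Σ[ s ∈ (ℕ → Unknowns) ] ((∀ k → IsSolution (s k))
    × (∀ k → IsExpressible (s k))
    × Injective _≡_ _≈ᵤ_ s))
    × AreFreeVariables IsFree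
    × length (freePositions N) ≡ N * (N ∸ 1) / 2 + ν N
theorem8p1 K char0 N η η-primitive = expressibleSolutions , freeVariables , Counting.length-freePositions N
  where open Linear K char0 N η η-primitive
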